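{- Let $b_{25}(n)$ denote the number of $25$-regular partitions of $n$. For all $\alpha\ge1$, $\beta\ge0$, $n\ge0$ and $i\in\{1,2\}$, $$b_{25}\left(2^{4\beta}3^{4\alpha}\cdot n+(i+3)\cdot2^{4\beta}3^{4\alpha-1}-1\right)\equiv0\pmod5$$ and $$b_{25}\left(2^{4\alpha}3^{4\beta}\cdot n+2^{4\alpha-1}3^{4\beta+1}-1\right)\equiv0\pmod5.$$
   Context: For $\ell\ge2$, a partition is $\ell$-regular if none of its parts is divisible by $\ell$; $b_\ell(n)$ is the number of $\ell$-regular partitions of $n$, with $b_\ell(0)=1$, and $\sum_{n\ge0}b_\ell(n)q^n=\prod_{n\ge1}\frac{1-q^{\ell n}}{1-q^n}$. -}

module Defs where

open import Data.List.Base using (List; []; _∷_; length; filter; upTo; cartesianProductWith)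
open import Data.List.Membership.Propositional using (_∈_)
open import Data.List.Membership.Propositional.Properties
  using (∈-upTo⁺; ∈-cartesianProductWith⁺; ∈-cartesianProductWith⁻; ∈-filter⁺; ∈-filter⁻)
open import Data.List.Properties using (∷-injective)
open import Data.List.Relation.Unary.All using (All; []; _∷_; all?)
open import Data.List.Relation.Unary.Any using (here; there)
open import Data.List.Relation.Unary.AllPairs using ([]; _∷_)
open import Data.List.Relation.Unary.Linked using (Linked; linked?)
open import Data.List.Relation.Unary.Unique.Propositional using (Unique)
import Data.List.Relation.Unary.All as All
import Data.List.Relation.Unary.Unique.Propositional.Properties as Unique
open import Data.Nat.Base using (ℕ; zero; suc; _≤_; _<_; _≥_; z≤n; s≤s)
open import Data.Nat.Divisibility using (_∤_; _∣?_)
open import Data.Nat.ListAction using (sum)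
open import Data.Nat.Properties
  using (_≟_; _≥?_; _<?_; ≤-trans; +-mono-≤; m≤m+n; m≤n+m)
open import Data.Product.Base using (_×_; _,_; proj₂)
open import Function.Bundles using (_⇔_; mk⇔)
open import Relation.Binary.PropositionalEquality using (_≡_; _≢_; refl)
open import Relation.Nullary.Decidable using (Dec; map′; _×-dec_; ¬?)

-- Partitions are represented by their weakly decreasing list of parts, so that
-- equal partitions are equal lists.
record IsPartition (n : ℕ) (ps : List ℕ) : Set where
  constructor isPartition
  field
    decreasing : Linked _≥_ ps
    positive   : All (0 <_) ps
    total      : sum ps ≡ n

IsRegular : ℕ → List ℕ → Set
IsRegular ℓ = All (ℓ ∤_)

IsRegularPartition : ℕ → ℕ → List ℕ → Set
IsRegularPartition ℓ n ps = IsPartition n ps × IsRegular ℓ ps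

isPartition? : ∀ n ps → Dec (IsPartition n ps)
isPartition? n ps = map′
  (λ (d , p , t) → isPartition d p t)
  (λ (isPartition d p t) → d , p , t)
  (linked? _≥?_ ps ×-dec all? (0 <?_) ps ×-dec (sum ps ≟ n))

isRegularPartition? : ∀ ℓ n ps → Dec (IsRegularPartition ℓ n ps)
isRegularPartition? ℓ n ps =
  isPartition? n ps ×-dec all? (λ p → ¬? (ℓ ∣? p)) ps

-- All lists of length at most k with entries at most m, without repetition.
boundedLists : ℕ → ℕ → List (List ℕ)
boundedLists m zero    = [] ∷ []
boundedLists m (suc k) =
  [] ∷ cartesianProductWith _∷_ (upTo (suc m)) (boundedLists m k)

-- A partition of n has at most n parts, each at most n, so filtering
-- boundedLists n n misses none; see ∈-regularPartitions below.
regularPartitions : ℕ → ℕ → List (List ℕ)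
regularPartitions ℓ n = filter (isRegularPartition? ℓ n) (boundedLists n n)

b : ℕ → ℕ → ℕ
b ℓ n = length (regularPartitions ℓ n)

∈-boundedLists : ∀ {m k ps} → length ps ≤ k → All (_≤ m) ps → ps ∈ boundedLists m k
∈-boundedLists {k = zero}  {[]}     _         _          = here refl
∈-boundedLists {k = suc k} {[]}     _         _          = here refl
∈-boundedLists {k = suc k} {p ∷ ps} (s≤s len) (p≤m ∷ ps≤m) =
  there (∈-cartesianProductWith⁺ _∷_ (∈-upTo⁺ (s≤s p≤m)) (∈-boundedLists len ps≤m))

length≤sum : ∀ {ps} → All (0 <_) ps → length ps ≤ sum ps
length≤sum []         = z≤n
length≤sum (p>0 ∷ pos) = +-mono-≤ p>0 (length≤sum pos)

parts≤sum : ∀ ps → All (_≤ sum ps) ps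
parts≤sum []       = []
parts≤sum (p ∷ ps) =
  m≤m+n p (sum ps) ∷ All.map (λ q≤ → ≤-trans q≤ (m≤n+m (sum ps) p)) (parts≤sum ps)

∈-regularPartitions : ∀ {ℓ n ps} → ps ∈ regularPartitions ℓ n ⇔ IsRegularPartition ℓ n ps
∈-regularPartitions {ℓ} {n} {ps} = mk⇔
  (λ ps∈ → proj₂ (∈-filter⁻ (isRegularPartition? ℓ n) {xs = boundedLists n n} ps∈))
  complete
  where
  complete : IsRegularPartition ℓ n ps → ps ∈ regularPartitions ℓ n
  complete r@(isPartition _ pos refl , _) =
    ∈-filter⁺ (isRegularPartition? ℓ n) (∈-boundedLists (length≤sum pos) (parts≤sum ps)) r

boundedLists-unique : ∀ m k → Unique (boundedLists m k)
boundedLists-unique m zero    = [] ∷ []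
boundedLists-unique m (suc k) =
  All.tabulate nonempty
    ∷ Unique.cartesianProductWith⁺ _∷_ ∷-injective (Unique.upTo⁺ (suc m)) (boundedLists-unique m k)
  where
  nonempty : ∀ {ps} → ps ∈ cartesianProductWith _∷_ (upTo (suc m)) (boundedLists m k) → [] ≢ ps
  nonempty ps∈ refl with ∈-cartesianProductWith⁻ _∷_ (upTo (suc m)) (boundedLists m k) ps∈
  ... | _ , _ , _ , _ , ()

regularPartitions-unique : ∀ ℓ n → Unique (regularPartitions ℓ n)
regularPartitions-unique ℓ n =
  Unique.filter⁺ (isRegularPartition? ℓ n) (boundedLists-unique n n)

{-# OPTIONS --safe #-}

-- Since 1 - q^(25 n) ≡ (1 - q^n)^25 modulo 5, the generating function of b₂₅ is congruent to
-- ∏ (1 - q^n)^24, so that b₂₅(n) ≡ τ(n + 1), and everything follows from τ(n) ≡ n σ(n) modulo 5.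
-- Write θ = q d/dq and let E₂, E₄, E₆ be the Eisenstein series. Ramanujan's formulas for θ E₄ and
-- θ E₆ give θ D = E₂ D for D = E₄³ - E₆². The series q ∏ (1 - q^n)^24 satisfies the same equation,
-- which determines a power series over ℤ up to a factor once its constant term vanishes, whence
-- D = 1728 q ∏ (1 - q^n)^24. As σ₅ ≡ σ₁ modulo 5, the formula for θ E₆ turns D into 3 ∑ n σ(n) q^n
-- modulo 5. Finally 1 + 2 + 4 + 8 and 1 + 3 + 9 + 27 are divisible by 5, so σ(p^(4k+3) m) is
-- divisible by 5 when p = 2 or 3 does not divide m.
--
-- The two formulas of Ramanujan are proved combinatorially, following Skoruppa: the map
-- (a , b , x , y) ↦ (a , a + b , x - y , y) sends the solutions of a x + b y = n with x > y
-- bijectively to those with b > a.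
module Submission where

open import Defs
open import Algebra.Bundles using (CommutativeRing)
import Algebra.Properties.CommutativeSemiring.Exp as Exp
import Algebra.Solver.Ring as RingSolver
open import Algebra.Solver.Ring.AlmostCommutativeRing
  using (fromCommutativeRing; _-Raw-AlmostCommutative⟶_)
open import Data.Empty using (⊥; ⊥-elim)
open import Data.Fin.Base using (zero; suc)
open import Data.Integer.Base as ℤ using (ℤ; +_; 0ℤ; 1ℤ)
import Data.Integer.Divisibility.Signed as ℤ
import Data.Integer.Properties as ℤ
import Data.Integer.Solver as ℤ
open import Data.Integer.Tactic.RingSolver using (solve-∀)
open import Data.List.Base using (List; []; _∷_; length; filter; map; _++_)
open import Data.List.Membership.Propositional using (_∈_)
open import Data.List.Membership.Propositional.Properties
  using (∈-filter⁺; ∈-filter⁻; ∈-map⁺; ∈-map⁻; ∈-++⁺ˡ; ∈-++⁺ʳ; ∈-++⁻)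
open import Data.List.Membership.Propositional.Properties.WithK using (unique∧set⇒bag)
import Data.List.Properties as List
open import Data.List.Relation.Binary.BagAndSetEquality using (∼bag⇒↭)
open import Data.List.Relation.Binary.Permutation.Propositional.Properties using (↭-length)
open import Data.List.Relation.Unary.All as All using (All; []; _∷_; all?)
open import Data.List.Relation.Unary.AllPairs using ([]; _∷_)
open import Data.List.Relation.Unary.Any using (here)
open import Data.List.Relation.Unary.Linked using (Linked; []; [-]; _∷_)
import Data.List.Relation.Unary.Linked.Properties as Linked
open import Data.List.Relation.Unary.Unique.Propositional using (Unique)
import Data.List.Relation.Unary.Unique.Propositional.Properties as Unique
import Data.Maybe.Base as Maybe
open import Data.Nat.Base as ℕ using (ℕ; zero; suc; z≤n; s≤s)
open import Data.Nat.Coprimality using (Coprime; coprime-divisor)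
import Data.Nat.Divisibility as ℕ
open import Data.Nat.Induction using (<-rec)
open import Data.Nat.ListAction using (sum)
open import Data.Nat.Primality
  using (Prime; prime?; prime⇒irreducible; euclidsLemma; prime⇒nonTrivial)
import Data.Nat.Properties as ℕ
import Data.Nat.Tactic.RingSolver as ℕ-Solver
open import Data.Product.Base using (_,_; ∃; proj₁; proj₂)
open import Data.Sum.Base using (inj₁; inj₂)
open import Data.Vec.Base using ([]; _∷_)
open import Function.Base using (_∘_; it)
open import Function.Bundles using (mk⇔; module Equivalence)
open import Level using (_⊔_; 0ℓ)
open import Relation.Binary.PropositionalEquality as ≡ using (_≢_; _≗_)
open import Relation.Nullary.Decidable using (yes; no; from-yes; dec⇒maybe)
open import Relation.Nullary.Negation using (contradiction)

open import Data.Nat.Divisibility using (_∣_)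
open import Data.Product.Base using (_×_)
open import Data.Sum.Base using (_⊎_)
open import Relation.Binary.PropositionalEquality using (_≡_)

-- Only finitely many coefficients matter for a given n, so power series are compared up to q^N, and
-- the Eisenstein series, the Euler product and the partition series become finite sums and
-- products; N = n + 1 is chosen at the very end. Ramanujan's formulas arise from the bijection as
-- follows. Sum a weight h(a, b) over the solutions of a x + b y = n, and compare with the sum of
-- h(a, -b). If h is invariant under the permutations of (a, b, -(a + b)) and under a common change
-- of sign, the strict parts of both sums agree and only the diagonals x = y and a = b survive. The
-- part of h that is odd in b gives products of divisor-sum series, the diagonal a = b gives a
-- derivative, and the diagonal x = y gives divisor sums of a polynomial. Thus each invariant
-- polynomial yields one differential equation; those of degree 4 and 6 suffice. To stay over ℤ, the
-- formulas are stated after division by 24 or -24, in terms of the divisor-sum series without the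
-- constant terms of the Eisenstein series.

module PowerSeries where

  open import Data.Integer.Base using (_+_; _*_; -_; _-_)
  open import Relation.Binary.PropositionalEquality
    using (refl; sym; trans; cong; cong₂; module ≡-Reasoning)
  open ≡-Reasoning

  -- Finite sums and their rearrangement.

  ∑ : ℕ → (ℕ → ℤ) → ℤ
  ∑ zero    f = 0ℤ
  ∑ (suc n) f = ∑ n f + f n

  ∑-cong-< : ∀ n {f g} → (∀ {i} → i ℕ.< n → f i ≡ g i) → ∑ n f ≡ ∑ n g
  ∑-cong-< zero    f≗g = refl
  ∑-cong-< (suc n) f≗g = cong₂ _+_ (∑-cong-< n (λ i<n → f≗g (ℕ.m<n⇒m<1+n i<n))) (f≗g ℕ.≤-refl)

  ∑-cong : ∀ n {f g} → (∀ i → f i ≡ g i) → ∑ n f ≡ ∑ n g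
  ∑-cong n f≗g = ∑-cong-< n (λ {i} _ → f≗g i)

  ∑-zero : ∀ n → ∑ n (λ _ → 0ℤ) ≡ 0ℤ
  ∑-zero zero    = refl
  ∑-zero (suc n) = trans (ℤ.+-identityʳ _) (∑-zero n)

  ∑-vanish : ∀ n {f} → (∀ i → f i ≡ 0ℤ) → ∑ n f ≡ 0ℤ
  ∑-vanish n f≗0 = trans (∑-cong n f≗0) (∑-zero n)

  ∑-+ : ∀ n f g → ∑ n (λ i → f i + g i) ≡ ∑ n f + ∑ n g
  ∑-+ zero    f g = refl
  ∑-+ (suc n) f g = trans (cong (_+ (f n + g n)) (∑-+ n f g)) (lemma (∑ n f) (∑ n g) (f n) (g n))
    where
    lemma : ∀ a b c d → a + b + (c + d) ≡ a + c + (b + d)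
    lemma = solve-∀

  ∑-*ˡ : ∀ n c f → ∑ n (λ i → c * f i) ≡ c * ∑ n f
  ∑-*ˡ zero    c f = sym (ℤ.*-zeroʳ c)
  ∑-*ˡ (suc n) c f = trans (cong (_+ c * f n) (∑-*ˡ n c f)) (sym (ℤ.*-distribˡ-+ c (∑ n f) (f n)))

  ∑-*ʳ : ∀ n c f → ∑ n (λ i → f i * c) ≡ ∑ n f * c
  ∑-*ʳ n c f = trans (∑-cong n (λ i → ℤ.*-comm (f i) c)) (trans (∑-*ˡ n c f) (ℤ.*-comm c _))

  ∑-swap : ∀ m n (f : ℕ → ℕ → ℤ) → ∑ m (λ i → ∑ n (f i)) ≡ ∑ n (λ j → ∑ m (λ i → f i j))
  ∑-swap zero    n f = sym (∑-zero n)
  ∑-swap (suc m) n f = trans (cong (_+ ∑ n (f m)) (∑-swap m n f)) (sym (∑-+ n _ (f m)))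

  ∑-head : ∀ n f → ∑ (suc n) f ≡ f 0 + ∑ n (f ∘ suc)
  ∑-head zero    f = ℤ.+-comm 0ℤ (f 0)
  ∑-head (suc n) f = trans (cong (_+ f (suc n)) (∑-head n f)) (ℤ.+-assoc (f 0) _ _)

  +-dropʳ : ∀ a {b} → b ≡ 0ℤ → a + b ≡ a
  +-dropʳ a refl = ℤ.+-identityʳ a

  ∑-extend : ∀ m n f → (∀ i → m ℕ.≤ i → f i ≡ 0ℤ) → ∑ (m ℕ.+ n) f ≡ ∑ m f
  ∑-extend m zero    f van = cong (λ k → ∑ k f) (ℕ.+-identityʳ m)
  ∑-extend m (suc n) f van = begin
    ∑ (m ℕ.+ suc n) f            ≡⟨ cong (λ k → ∑ k f) (ℕ.+-suc m n) ⟩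
    ∑ (m ℕ.+ n) f + f (m ℕ.+ n)  ≡⟨ cong₂ _+_ (∑-extend m n f van) (van _ (ℕ.m≤m+n m n)) ⟩
    ∑ m f + 0ℤ                   ≡⟨ ℤ.+-identityʳ _ ⟩
    ∑ m f                        ∎

  ∑-square : ∀ n (g : ℕ → ℕ → ℤ) →
    ∑ n (λ x → ∑ n (g x))
      ≡ ∑ n (λ x → g x x) + (∑ n (λ x → ∑ x (g x)) + ∑ n (λ y → ∑ y (λ x → g x y)))
  ∑-square zero    g = refl
  ∑-square (suc n) g = begin
    ∑ n (λ x → ∑ n (g x) + g x n) + (∑ n (g n) + g n n)
      ≡⟨ cong (_+ (∑ n (g n) + g n n)) (∑-+ n _ _) ⟩
    ∑ n (λ x → ∑ n (g x)) + ∑ n (λ x → g x n) + (∑ n (g n) + g n n)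
      ≡⟨ cong (λ s → s + ∑ n (λ x → g x n) + (∑ n (g n) + g n n)) (∑-square n g) ⟩
    ∑ n (λ x → g x x) + (∑ n (λ x → ∑ x (g x)) + ∑ n (λ y → ∑ y (λ x → g x y)))
      + ∑ n (λ x → g x n) + (∑ n (g n) + g n n)
      ≡⟨ lemma (∑ n (λ x → g x x)) (∑ n (λ x → ∑ x (g x))) (∑ n (λ y → ∑ y (λ x → g x y)))
               (∑ n (λ x → g x n)) (∑ n (g n)) (g n n) ⟩
    ∑ (suc n) (λ x → g x x) + (∑ (suc n) (λ x → ∑ x (g x)) + ∑ (suc n) (λ y → ∑ y (λ x → g x y)))
      ∎
    where
    lemma : ∀ a b c d e f → a + (b + c) + d + (e + f) ≡ a + f + (b + e + (c + d))
    lemma = solve-∀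

  -- Substitution x = y + z + 1. The vanishing hypothesis makes the points added to the triangle
  -- harmless, so that y and z may both run up to n independently.
  ∑-triangle : ∀ n (g : ℕ → ℕ → ℤ) → (∀ x y → n ℕ.≤ x → g x y ≡ 0ℤ) →
    ∑ n (λ x → ∑ x (g x)) ≡ ∑ n (λ y → ∑ n (λ z → g (suc (y ℕ.+ z)) y))
  ∑-triangle zero    g van = refl
  ∑-triangle (suc n) g van = begin
    ∑ (suc n) (λ x → ∑ x (g x))
      ≡⟨ ∑-head n _ ⟩
    0ℤ + ∑ n (λ x → ∑ (suc x) (g (suc x)))
      ≡⟨ ℤ.+-identityˡ _ ⟩
    ∑ n (λ x → ∑ (suc x) (g (suc x)))
      ≡⟨ ∑-cong n (λ x → ∑-head x (g (suc x))) ⟩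
    ∑ n (λ x → g (suc x) 0 + ∑ x (g (suc x) ∘ suc))
      ≡⟨ ∑-+ n _ _ ⟩
    ∑ n (λ x → g (suc x) 0) + ∑ n (λ x → ∑ x (g (suc x) ∘ suc))
      ≡⟨ cong₂ _+_
           (sym (+-dropʳ (∑ n (λ x → g (suc x) 0)) (van (suc n) 0 ℕ.≤-refl)))
           (trans (∑-triangle n (λ x y → g (suc x) (suc y)) (λ x y n≤x → van (suc x) (suc y) (s≤s n≤x)))
                  (∑-cong n (λ y → sym (+-dropʳ _
                    (van _ (suc y) (s≤s (ℕ.≤-trans (ℕ.m≤n+m n y) (ℕ.n≤1+n _)))))))) ⟩
    ∑ (suc n) (λ z → g (suc z) 0) + ∑ n (λ y → ∑ (suc n) (λ z → g (suc (suc y ℕ.+ z)) (suc y)))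
      ≡⟨ ∑-head n _ ⟨
    ∑ (suc n) (λ y → ∑ (suc n) (λ z → g (suc (y ℕ.+ z)) y))
      ∎

  -- Formal power series over ℤ.

  Series : Set
  Series = ℕ → ℤ

  infixl 7 _⊛_
  infixl 6 _⊕_

  tail : Series → Series
  tail f = f ∘ suc

  _⊕_ : Series → Series → Series
  (f ⊕ g) n = f n + g n

  -- Recursion on the tail of the first factor avoids the index n - i of the Cauchy product, so that
  -- the ring laws follow by induction without truncated subtraction.
  _⊛_ : Series → Series → Series
  (f ⊛ g) zero    = f 0 * g 0
  (f ⊛ g) (suc n) = f 0 * g (suc n) + (tail f ⊛ g) n

  -- mono m is q^m.
  mono : ℕ → Series
  mono zero    zero    = 1ℤ
  mono zero    (suc n) = 0ℤ
  mono (suc m) zero    = 0ℤ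
  mono (suc m) (suc n) = mono m n

  θ : Series → Series
  θ f n = + n * f n

  mono-diag : ∀ m → mono m m ≡ 1ℤ
  mono-diag zero    = refl
  mono-diag (suc m) = mono-diag m

  mono-off : ∀ {m n} → m ≢ n → mono m n ≡ 0ℤ
  mono-off {zero}  {zero}  m≢n = contradiction refl m≢n
  mono-off {zero}  {suc n} m≢n = refl
  mono-off {suc m} {zero}  m≢n = refl
  mono-off {suc m} {suc n} m≢n = mono-off (m≢n ∘ cong suc)

  -- Both sides vanish unless m = n. With F the inclusion of ℕ in ℤ, this trades the factor n
  -- produced by `θ` for the exponent of the monomial.
  mono-support : ∀ m n (F : ℕ → ℤ) → F m * mono m n ≡ F n * mono m n
  mono-support m n F with m ℕ.≟ n
  ... | yes refl = refl
  ... | no m≢n   = trans (cong (F m *_) (mono-off m≢n))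
                     (trans (trans (ℤ.*-zeroʳ (F m)) (sym (ℤ.*-zeroʳ (F n))))
                       (cong (F n *_) (sym (mono-off m≢n))))

  ⊛-cong : ∀ n {f f′ g g′} → (∀ i → i ℕ.≤ n → f i ≡ f′ i) → (∀ i → i ℕ.≤ n → g i ≡ g′ i) →
    (f ⊛ g) n ≡ (f′ ⊛ g′) n
  ⊛-cong zero    f≈ g≈ = cong₂ _*_ (f≈ 0 z≤n) (g≈ 0 z≤n)
  ⊛-cong (suc n) f≈ g≈ =
    cong₂ _+_ (cong₂ _*_ (f≈ 0 z≤n) (g≈ (suc n) ℕ.≤-refl))
              (⊛-cong n (λ i i≤n → f≈ (suc i) (s≤s i≤n)) (λ i i≤n → g≈ i (ℕ.m≤n⇒m≤1+n i≤n)))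

  ⊛-sucʳ : ∀ f g n → (f ⊛ g) (suc n) ≡ (f ⊛ tail g) n + f (suc n) * g 0
  ⊛-sucʳ f g zero    = refl
  ⊛-sucʳ f g (suc n) =
    trans (cong₂ _+_ {x = f 0 * g (suc (suc n))} refl (⊛-sucʳ (tail f) g n))
      (sym (ℤ.+-assoc (f 0 * g (suc (suc n))) _ _))

  ⊛-comm : ∀ f g n → (f ⊛ g) n ≡ (g ⊛ f) n
  ⊛-comm f g zero    = ℤ.*-comm (f 0) (g 0)
  ⊛-comm f g (suc n) = begin
    f 0 * g (suc n) + (tail f ⊛ g) n ≡⟨ cong₂ _+_ (ℤ.*-comm (f 0) _) (⊛-comm (tail f) g n) ⟩
    g (suc n) * f 0 + (g ⊛ tail f) n ≡⟨ ℤ.+-comm (g (suc n) * f 0) _ ⟩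
    (g ⊛ tail f) n + g (suc n) * f 0 ≡⟨ ⊛-sucʳ g f n ⟨
    (g ⊛ f) (suc n)                  ∎

  ⊛-distribʳ : ∀ h f g n → ((f ⊕ g) ⊛ h) n ≡ (f ⊛ h) n + (g ⊛ h) n
  ⊛-distribʳ h f g zero    = ℤ.*-distribʳ-+ (h 0) (f 0) (g 0)
  ⊛-distribʳ h f g (suc n) =
    trans (cong₂ _+_ {x = (f 0 + g 0) * h (suc n)} refl (⊛-distribʳ h (tail f) (tail g) n))
          (lemma (f 0) (g 0) (h (suc n)) ((tail f ⊛ h) n) ((tail g ⊛ h) n))
    where
    lemma : ∀ a b c x y → (a + b) * c + (x + y) ≡ a * c + x + (b * c + y)
    lemma = solve-∀

  ⊛-scaleˡ : ∀ c f g n → ((λ i → c * f i) ⊛ g) n ≡ c * (f ⊛ g) n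
  ⊛-scaleˡ c f g zero    = ℤ.*-assoc c (f 0) (g 0)
  ⊛-scaleˡ c f g (suc n) =
    trans (cong₂ _+_ {x = c * f 0 * g (suc n)} refl (⊛-scaleˡ c (tail f) g n))
      (lemma c (f 0) (g (suc n)) ((tail f ⊛ g) n))
    where
    lemma : ∀ c a b x → c * a * b + c * x ≡ c * (a * b + x)
    lemma = solve-∀

  ⊛-assoc : ∀ f g h n → ((f ⊛ g) ⊛ h) n ≡ (f ⊛ (g ⊛ h)) n
  ⊛-assoc f g h zero    = ℤ.*-assoc (f 0) (g 0) (h 0)
  ⊛-assoc f g h (suc n) = begin
    f 0 * g 0 * h (suc n) + ((λ i → f 0 * tail g i + (tail f ⊛ g) i) ⊛ h) n
      ≡⟨ cong₂ _+_ {x = f 0 * g 0 * h (suc n)} refl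
        (⊛-distribʳ h (λ i → f 0 * tail g i) (tail f ⊛ g) n) ⟩
    f 0 * g 0 * h (suc n) + (((λ i → f 0 * tail g i) ⊛ h) n + ((tail f ⊛ g) ⊛ h) n)
      ≡⟨ cong₂ _+_ {x = f 0 * g 0 * h (suc n)} refl
        (cong₂ _+_ (⊛-scaleˡ (f 0) (tail g) h n) (⊛-assoc (tail f) g h n)) ⟩
    f 0 * g 0 * h (suc n) + (f 0 * (tail g ⊛ h) n + (tail f ⊛ (g ⊛ h)) n)
      ≡⟨ lemma (f 0) (g 0) (h (suc n)) _ _ ⟩
    f 0 * (g 0 * h (suc n) + (tail g ⊛ h) n) + (tail f ⊛ (g ⊛ h)) n
      ∎
    where
    lemma : ∀ a b c x y → a * b * c + (a * x + y) ≡ a * (b * c + x) + y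
    lemma = solve-∀

  ⊛-zeroˡ : ∀ f n → ((λ _ → 0ℤ) ⊛ f) n ≡ 0ℤ
  ⊛-zeroˡ f zero    = refl
  ⊛-zeroˡ f (suc n) = trans (ℤ.+-identityˡ _) (⊛-zeroˡ f n)

  ⊛-identityˡ : ∀ f n → (mono 0 ⊛ f) n ≡ f n
  ⊛-identityˡ f zero    = ℤ.*-identityˡ (f 0)
  ⊛-identityˡ f (suc n) =
    trans (cong₂ _+_ (ℤ.*-identityˡ (f (suc n))) (⊛-zeroˡ f n)) (ℤ.+-identityʳ _)

  mono-⊛ : ∀ u v n → (mono u ⊛ mono v) n ≡ mono (u ℕ.+ v) n
  mono-⊛ zero    v n       = ⊛-identityˡ (mono v) n
  mono-⊛ (suc u) v zero    = refl
  mono-⊛ (suc u) v (suc n) = trans (ℤ.+-identityˡ _) (mono-⊛ u v n)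

  ⊛-∑ˡ : ∀ k (F : ℕ → Series) g n → ((λ i → ∑ k (λ a → F a i)) ⊛ g) n ≡ ∑ k (λ a → (F a ⊛ g) n)
  ⊛-∑ˡ zero    F g n = ⊛-zeroˡ g n
  ⊛-∑ˡ (suc k) F g n = trans (⊛-distribʳ g _ (F k) n) (cong (_+ (F k ⊛ g) n) (⊛-∑ˡ k F g n))

  ⊛-∑ʳ : ∀ k f (F : ℕ → Series) n → (f ⊛ (λ i → ∑ k (λ a → F a i))) n ≡ ∑ k (λ a → (f ⊛ F a) n)
  ⊛-∑ʳ k f F n = trans (⊛-comm f _ n) (trans (⊛-∑ˡ k F f n) (∑-cong k (λ a → ⊛-comm (F a) f n)))

  ⊛-scaleʳ : ∀ c f g n → (f ⊛ (λ i → c * g i)) n ≡ c * (f ⊛ g) n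
  ⊛-scaleʳ c f g n = trans (⊛-comm f _ n) (trans (⊛-scaleˡ c g f n) (cong (c *_) (⊛-comm g f n)))

  θ-⊛ : ∀ f g n → θ (f ⊛ g) n ≡ (θ f ⊛ g) n + (f ⊛ θ g) n
  θ-⊛ f g zero    = sym (trans (ℤ.+-identityˡ _) (ℤ.*-zeroʳ (f 0)))
  θ-⊛ f g (suc n) = begin
    + suc n * (f 0 * g (suc n) + (tail f ⊛ g) n)
      ≡⟨ step (+ n) (f 0) (g (suc n)) _ ⟩
    + suc n * (f 0 * g (suc n)) + ((tail f ⊛ g) n + + n * (tail f ⊛ g) n)
      ≡⟨ cong (λ s → + suc n * (f 0 * g (suc n)) + ((tail f ⊛ g) n + s)) (θ-⊛ (tail f) g n) ⟩
    + suc n * (f 0 * g (suc n)) + ((tail f ⊛ g) n + ((θ (tail f) ⊛ g) n + (tail f ⊛ θ g) n))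
      ≡⟨ lemma (+ suc n) (f 0) (g (suc n)) ((tail f ⊛ g) n) _ _ ⟩
    0ℤ * g (suc n) + ((tail f ⊛ g) n + (θ (tail f) ⊛ g) n) +
      (f 0 * (+ suc n * g (suc n)) + (tail f ⊛ θ g) n)
      ≡⟨ cong (λ s → 0ℤ * g (suc n) + s + (f 0 * (+ suc n * g (suc n)) + (tail f ⊛ θ g) n))
           (trans (sym (⊛-distribʳ g (tail f) (θ (tail f)) n))
                  (⊛-cong n (λ i _ → sym (ℤ.suc-* (+ i) (f (suc i)))) (λ _ _ → refl))) ⟩
    0ℤ * g (suc n) + (tail (θ f) ⊛ g) n + (f 0 * (+ suc n * g (suc n)) + (tail f ⊛ θ g) n)
      ∎
    where
    step : ∀ m a b c → (1ℤ + m) * (a * b + c) ≡ (1ℤ + m) * (a * b) + (c + m * c)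
    step = solve-∀
    lemma : ∀ m a b x y z → m * (a * b) + (x + (y + z)) ≡ 0ℤ * b + (x + y) + (a * (m * b) + z)
    lemma = solve-∀

  module _ (N : ℕ) where

    -- ℤ[[q]] modulo q^(N+1).
    truncatedSeries : CommutativeRing 0ℓ 0ℓ
    truncatedSeries = record
      { Carrier = Series
      ; _≈_     = λ f g → ∀ n → n ℕ.≤ N → f n ≡ g n
      ; _+_     = _⊕_
      ; _*_     = _⊛_
      ; -_      = λ f n → - f n
      ; 0#      = λ _ → 0ℤ
      ; 1#      = mono 0
      ; isCommutativeRing = record
        { isRing = record
          { +-isAbelianGroup = record
            { isGroup = record
              { isMonoid = record
                { isSemigroup = record
                  { isMagma = record
                    { isEquivalence = record
                      { refl  = λ _ _ → refl
                      ; sym   = λ p n n≤N → sym (p n n≤N)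
                      ; trans = λ p q n n≤N → trans (p n n≤N) (q n n≤N)
                      }
                    ; ∙-cong = λ p q n n≤N → cong₂ _+_ (p n n≤N) (q n n≤N)
                    }
                  ; assoc = λ f g h n _ → ℤ.+-assoc (f n) (g n) (h n)
                  }
                ; identity = (λ f n _ → ℤ.+-identityˡ (f n)) , (λ f n _ → ℤ.+-identityʳ (f n))
                }
              ; inverse = (λ f n _ → ℤ.+-inverseˡ (f n)) , (λ f n _ → ℤ.+-inverseʳ (f n))
              ; ⁻¹-cong = λ p n n≤N → cong -_ (p n n≤N)
              }
            ; comm = λ f g n _ → ℤ.+-comm (f n) (g n)
            }
          ; *-cong = λ p q n n≤N →
              ⊛-cong n (λ i i≤n → p i (ℕ.≤-trans i≤n n≤N)) (λ i i≤n → q i (ℕ.≤-trans i≤n n≤N))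
          ; *-assoc = λ f g h n _ → ⊛-assoc f g h n
          ; *-identity = (λ f n _ → ⊛-identityˡ f n)
                       , (λ f n _ → trans (⊛-comm f (mono 0) n) (⊛-identityˡ f n))
          ; distrib = (λ h f g n _ → trans (⊛-comm h (f ⊕ g) n) (trans (⊛-distribʳ h f g n)
                                       (cong₂ _+_ (⊛-comm f h n) (⊛-comm g h n))))
                    , (λ h f g n _ → ⊛-distribʳ h f g n)
          }
        ; *-comm = λ f g n _ → ⊛-comm f g n
        }
      }

open PowerSeries

-- Lambert series and Ramanujan's differential equations.

module LambertSeries where

  open import Algebra.Properties.AbelianGroup ℤ.+-0-abelianGroup
    using () renaming (∙-cancelˡ to +-cancelˡ)
  open import Data.Integer.Base using (_+_; _*_; -_; _-_)
  open import Relation.Binary.PropositionalEquality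
    using (refl; sym; trans; cong; cong₂; module ≡-Reasoning)
  open ≡-Reasoning
  open ℤ.+-*-Solver using (solve; con; _:+_; _:*_; _:-_; :-_; _:=_; Polynomial; var; ⟦_⟧)

  ∑∑ : ℕ → (ℕ → ℕ → ℤ) → ℤ
  ∑∑ n f = ∑ n (λ i → ∑ n (f i))

  ∑∑-cong : ∀ n {f g : ℕ → ℕ → ℤ} → (∀ i j → f i j ≡ g i j) → ∑∑ n f ≡ ∑∑ n g
  ∑∑-cong n f≗g = ∑-cong n (λ i → ∑-cong n (f≗g i))

  ∑∑-+ : ∀ n (f g : ℕ → ℕ → ℤ) → ∑∑ n (λ i j → f i j + g i j) ≡ ∑∑ n f + ∑∑ n g
  ∑∑-+ n f g = trans (∑-cong n (λ i → ∑-+ n (f i) (g i))) (∑-+ n _ _)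

  ∑∑-*ˡ : ∀ n c (f : ℕ → ℕ → ℤ) → ∑∑ n (λ i j → c * f i j) ≡ c * ∑∑ n f
  ∑∑-*ˡ n c f = trans (∑-cong n (λ i → ∑-*ˡ n c (f i))) (∑-*ˡ n c _)

  ∑∑-swap : ∀ n (f : ℕ → ℕ → ℕ → ℕ → ℤ) →
    ∑∑ n (λ i j → ∑∑ n (f i j)) ≡ ∑∑ n (λ k l → ∑∑ n (λ i j → f i j k l))
  ∑∑-swap n f = begin
    ∑ n (λ i → ∑ n (λ j → ∑ n (λ k → ∑ n (f i j k))))
      ≡⟨ ∑-cong n (λ i → ∑-swap n n (λ j k → ∑ n (f i j k))) ⟩
    ∑ n (λ i → ∑ n (λ k → ∑ n (λ j → ∑ n (f i j k))))
      ≡⟨ ∑-cong n (λ i → ∑-cong n (λ k → ∑-swap n n (λ j → f i j k))) ⟩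
    ∑ n (λ i → ∑ n (λ k → ∑ n (λ l → ∑ n (λ j → f i j k l))))
      ≡⟨ ∑-swap n n _ ⟩
    ∑ n (λ k → ∑ n (λ i → ∑ n (λ l → ∑ n (λ j → f i j k l))))
      ≡⟨ ∑-cong n (λ k → ∑-swap n n (λ i l → ∑ n (λ j → f i j k l))) ⟩
    ∑∑ n (λ k l → ∑∑ n (λ i j → f i j k l))
      ∎

  ∑∑-split : ∀ n (g : ℕ → ℕ → ℤ) →
    (∀ x y → n ℕ.≤ x → g x y ≡ 0ℤ) → (∀ x y → n ℕ.≤ y → g x y ≡ 0ℤ) →
    ∑∑ n g ≡ ∑ n (λ x → g x x)
      + (∑∑ n (λ y z → g (suc (y ℕ.+ z)) y) + ∑∑ n (λ x z → g x (suc (x ℕ.+ z))))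
  ∑∑-split n g vanˡ vanʳ = trans (∑-square n g)
    (cong (λ s → ∑ n (λ x → g x x) + s)
          (cong₂ _+_ (∑-triangle n g vanˡ) (∑-triangle n (λ y x → g x y) (λ y x n≤y → vanʳ x y n≤y))))

  -- The sum of f a b over the solutions of a x + b y = n, when φ is the indicator function of n.
  quadruples : ℕ → (ℕ → ℤ) → (ℤ → ℤ → ℤ) → ℤ
  quadruples N φ f = ∑∑ N λ a b → ∑∑ N λ x y →
    f (+ suc a) (+ suc b) * φ (suc a ℕ.* suc x ℕ.+ suc b ℕ.* suc y)

  -- The symmetry hypotheses on h say that it is invariant under all permutations of the triple
  -- (a , b , -(a + b)) and under changing the sign of all three.
  module SymmetricTriples
    (N : ℕ) (φ : ℕ → ℤ) (φ-vanish : ∀ {m} → N ℕ.< m → φ m ≡ 0ℤ)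
    (h : ℤ → ℤ → ℤ)
    (h-sym  : ∀ a b → h a b ≡ h b a)
    (h-rotʳ : ∀ a b → h a (- (a + b)) ≡ h a b)
    (h-rotˡ : ∀ a b → h (a + b) (- a) ≡ h a b)
    (R : ℤ → ℤ) (R-sum : ∀ d → ∑ d (λ a → h (+ suc a) (- + suc d)) ≡ R (+ suc d))
    where

    private
      van₁ : ∀ c x m → N ℕ.≤ x → φ (suc x ℕ.* suc c ℕ.+ m) ≡ 0ℤ
      van₁ c x m N≤x = φ-vanish (ℕ.≤-trans (s≤s N≤x)
        (ℕ.≤-trans (ℕ.m≤m*n (suc x) (suc c)) (ℕ.m≤m+n _ m)))

      van₂ : ∀ c x m → N ℕ.≤ x → φ (suc c ℕ.* suc x ℕ.+ m) ≡ 0ℤ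
      van₂ c x m N≤x = trans (cong (λ k → φ (k ℕ.+ m)) (ℕ.*-comm (suc c) (suc x))) (van₁ c x m N≤x)

      van₃ : ∀ c x m → N ℕ.≤ x → φ (m ℕ.+ suc x ℕ.* suc c) ≡ 0ℤ
      van₃ c x m N≤x = trans (cong φ (ℕ.+-comm m _)) (van₁ c x m N≤x)

      van₄ : ∀ c x m → N ℕ.≤ x → φ (m ℕ.+ suc c ℕ.* suc x) ≡ 0ℤ
      van₄ c x m N≤x = trans (cong φ (ℕ.+-comm m _)) (van₂ c x m N≤x)

      *-van : ∀ c {e} → e ≡ 0ℤ → c * e ≡ 0ℤ
      *-van c refl = ℤ.*-zeroʳ c

      -- `D₁` comes from the solutions with x = y and `D₂` from those with a = b, the two diagonals
      -- that the bijection leaves out. `K` is the part x > y of the sum of h(a, b), with x written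
      -- as y plus a positive excess.
      D₁ D₂ K : ℤ
      D₁ = ∑∑ N λ a b → ∑ N λ x → h (+ suc a) (+ suc b) * φ (suc a ℕ.* suc x ℕ.+ suc b ℕ.* suc x)
      D₂ = ∑∑ N λ x y → ∑ N λ a → h (+ suc a) (- + suc a) * φ (suc a ℕ.* suc x ℕ.+ suc a ℕ.* suc y)
      K  = ∑∑ N λ a b → ∑∑ N λ y z →
             h (+ suc a) (+ suc b) * φ (suc a ℕ.* suc (suc (y ℕ.+ z)) ℕ.+ suc b ℕ.* suc y)

    private
      -- The part x < y turns into the part x > y when (a , x) and (b , y) are exchanged.
      split-xy : quadruples N φ h ≡ D₁ + (K + K)
      split-xy = begin
        quadruples N φ h
          ≡⟨ ∑∑-cong N (λ a b → ∑∑-split N _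
               (λ x y N≤x → *-van (h (+ suc a) (+ suc b)) (van₂ a x _ N≤x))
               (λ x y N≤y → *-van (h (+ suc a) (+ suc b)) (van₄ b y (suc a ℕ.* suc x) N≤y))) ⟩
        (∑∑ N λ a b → d a b + (k a b + k′ a b))
          ≡⟨ trans (∑∑-+ N d _) (cong₂ _+_ {x = D₁} refl (∑∑-+ N k k′)) ⟩
        D₁ + (K + ∑∑ N k′)
          ≡⟨ cong (λ s → D₁ + (K + s)) K′≡K ⟩
        D₁ + (K + K)
          ∎
        where
        d k k′ : ℕ → ℕ → ℤ
        d a b = ∑ N λ x → h (+ suc a) (+ suc b) * φ (suc a ℕ.* suc x ℕ.+ suc b ℕ.* suc x)
        k a b = ∑∑ N λ y z → h (+ suc a) (+ suc b) * φ
          (suc a ℕ.* suc (suc (y ℕ.+ z)) ℕ.+ suc b ℕ.* suc y)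
        k′ a b = ∑∑ N λ y z → h (+ suc a) (+ suc b) * φ
          (suc a ℕ.* suc y ℕ.+ suc b ℕ.* suc (suc (y ℕ.+ z)))
        K′≡K : ∑∑ N k′ ≡ K
        K′≡K = trans (∑-swap N N k′) (∑∑-cong N λ b a → ∑∑-cong N λ y z →
          cong₂ (λ c m → c * φ m) (h-sym (+ suc a) (+ suc b)) (ℕ.+-comm (suc a ℕ.* suc y) _))

      -- For a = b + c, the equation reads b (x + y) + c x = n with x + y > x, and h(b + c, -b) =
      -- h(b, c); this is `K` again. For b = a + c it reads a (x + y) + c y = n, and h(a, -(a + c))
      -- = h(a, c).
      split-ab : quadruples N φ (λ a b → h a (- b)) ≡ D₂ + (K + K)
      split-ab = begin
        quadruples N φ (λ a b → h a (- b))
          ≡⟨ ∑∑-swap N _ ⟩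
        (∑∑ N λ x y → ∑∑ N λ a b → h (+ suc a) (- + suc b) * φ (suc a ℕ.* suc x ℕ.+ suc b ℕ.* suc y))
          ≡⟨ ∑∑-cong N (λ x y → ∑∑-split N _
               (λ a b N≤a → *-van (h (+ suc a) (- + suc b)) (van₁ x a _ N≤a))
               (λ a b N≤b → *-van (h (+ suc a) (- + suc b)) (van₃ y b (suc a ℕ.* suc x) N≤b))) ⟩
        (∑∑ N λ x y → d x y + (k x y + k′ x y))
          ≡⟨ trans (∑∑-+ N d _) (cong₂ _+_ {x = D₂} refl (∑∑-+ N k k′)) ⟩
        D₂ + (∑∑ N k + ∑∑ N k′)
          ≡⟨ cong (λ s → D₂ + s) (cong₂ _+_ k≡K k′≡K) ⟩
        D₂ + (K + K)
          ∎
        where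
        d k k′ : ℕ → ℕ → ℤ
        d x y = ∑ N λ a → h (+ suc a) (- + suc a) * φ (suc a ℕ.* suc x ℕ.+ suc a ℕ.* suc y)
        k x y = ∑∑ N λ b c →
          h (+ suc (suc (b ℕ.+ c))) (- + suc b) * φ (suc (suc (b ℕ.+ c)) ℕ.* suc x ℕ.+ suc b ℕ.* suc y)
        k′ x y = ∑∑ N λ a c →
          h (+ suc a) (- + suc (suc (a ℕ.+ c))) * φ (suc a ℕ.* suc x ℕ.+ suc (suc (a ℕ.+ c)) ℕ.* suc y)
        suc-suc : ∀ a c → + suc (suc (a ℕ.+ c)) ≡ + suc a + + suc c
        suc-suc a c = cong +_ (cong suc (sym (ℕ.+-suc a c)))
        k≡K : ∑∑ N k ≡ K
        k≡K = trans (∑∑-swap N _) (∑∑-cong N λ b c → ∑∑-cong N λ x y →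
          cong₂ (λ e m → e * φ m)
            (trans (cong (λ e → h e (- + suc b)) (suc-suc b c)) (h-rotˡ (+ suc b) (+ suc c)))
            (lemma b c x y))
          where
          lemma : ∀ b c x y → suc (suc (b ℕ.+ c)) ℕ.* suc x ℕ.+ suc b ℕ.* suc y
                            ≡ suc b ℕ.* suc (suc (x ℕ.+ y)) ℕ.+ suc c ℕ.* suc x
          lemma = ℕ-Solver.solve-∀
        k′≡K : ∑∑ N k′ ≡ K
        k′≡K = trans (∑∑-swap N _) (∑∑-cong N λ a c → trans (∑-swap N N _) (∑∑-cong N λ y x →
          cong₂ (λ e m → e * φ m)
            (trans (cong (λ e → h (+ suc a) (- e)) (suc-suc a c)) (h-rotʳ (+ suc a) (+ suc c)))
            (lemma a c x y)))
          where
          lemma : ∀ a c x y → suc a ℕ.* suc x ℕ.+ suc (suc (a ℕ.+ c)) ℕ.* suc y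
                            ≡ suc a ℕ.* suc (suc (y ℕ.+ x)) ℕ.+ suc c ℕ.* suc y
          lemma = ℕ-Solver.solve-∀

      -- When x = y, only d = a + b enters the equation. As h(a, b) = h(a, -d), the weights for
      -- fixed d add up to R d.
      D₁-sum : D₁ ≡ ∑∑ N λ d x → R (+ suc d) * φ (suc d ℕ.* suc x)
      D₁-sum = begin
        D₁
          ≡⟨ ∑∑-cong N (λ a b → ∑-cong N λ x → cong₂ (λ c m → c * φ m)
               (sym (trans (cong (λ e → h (+ suc a) (- + suc e)) (sym (ℕ.+-suc a b)))
                 (h-rotʳ (+ suc a) (+ suc b))))
               (lemma a b x)) ⟩
        (∑∑ N λ a b → g (suc (a ℕ.+ b)) a)
          ≡⟨ ∑-triangle N g (λ d a N≤d → ∑-vanish N λ x →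
               *-van (h (+ suc a) (- + suc d))
                 (trans (cong φ (sym (ℕ.+-identityʳ _))) (van₁ x d 0 N≤d))) ⟨
        (∑ N λ d → ∑ d (g d))
          ≡⟨ ∑-cong N (λ d → trans (∑-swap d N _) (∑-cong N λ x →
               trans (∑-*ʳ d (φ (suc d ℕ.* suc x)) _) (cong (_* φ (suc d ℕ.* suc x)) (R-sum d)))) ⟩
        (∑∑ N λ d x → R (+ suc d) * φ (suc d ℕ.* suc x))
          ∎
        where
        g : ℕ → ℕ → ℤ
        g d a = ∑ N λ x → h (+ suc a) (- + suc d) * φ (suc d ℕ.* suc x)
        lemma : ∀ a b x → suc a ℕ.* suc x ℕ.+ suc b ℕ.* suc x ≡ suc (suc (a ℕ.+ b)) ℕ.* suc x
        lemma = ℕ-Solver.solve-∀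

      ∑-const : ∀ n c → ∑ n (λ _ → c) ≡ + n * c
      ∑-const zero    c = refl
      ∑-const (suc n) c = trans (cong (_+ c) (∑-const n c))
        (trans (ℤ.+-comm (+ n * c) c) (sym (ℤ.suc-* (+ n) c)))

      -- When a = b, only x + y = u + 1 enters the equation, and u + 1 is a sum of two positive
      -- integers in u ways.
      D₂-sum : D₂ ≡ ∑∑ N λ a u → + u * h (+ suc a) (- + suc a) * φ (suc a ℕ.* suc u)
      D₂-sum = begin
        D₂
          ≡⟨ ∑∑-cong N (λ x y → ∑-cong N λ a → cong (λ m → h (+ suc a) (- + suc a) * φ m)
            (lemma a x y)) ⟩
        (∑∑ N λ x y → g (suc (x ℕ.+ y)))
          ≡⟨ ∑-triangle N (λ u _ → g u) (λ u _ N≤u → ∑-vanish N λ a →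
               *-van (h (+ suc a) (- + suc a))
                 (trans (cong φ (sym (ℕ.+-identityʳ _))) (van₂ a u 0 N≤u))) ⟨
        (∑ N λ u → ∑ u λ _ → g u)
          ≡⟨ ∑-cong N (λ u → trans (∑-const u (g u)) (trans (sym (∑-*ˡ N (+ u) _))
               (∑-cong N λ a → sym (ℤ.*-assoc (+ u) (h (+ suc a) (- + suc a)) _)))) ⟩
        (∑∑ N λ u a → + u * h (+ suc a) (- + suc a) * φ (suc a ℕ.* suc u))
          ≡⟨ ∑-swap N N _ ⟩
        (∑∑ N λ a u → + u * h (+ suc a) (- + suc a) * φ (suc a ℕ.* suc u))
          ∎
        where
        g : ℕ → ℤ
        g u = ∑ N λ a → h (+ suc a) (- + suc a) * φ (suc a ℕ.* suc u)
        lemma : ∀ a x y → suc a ℕ.* suc x ℕ.+ suc a ℕ.* suc y ≡ suc a ℕ.* suc (suc (x ℕ.+ y))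
        lemma = ℕ-Solver.solve-∀

    -- The strict parts agree. Adding to each side the diagonal of the other keeps the identity free
    -- of subtraction.
    reflection-identity :
      quadruples N φ h + ∑∑ N (λ a u → + u * h (+ suc a) (- + suc a) * φ (suc a ℕ.* suc u))
        ≡ quadruples N φ (λ a b → h a (- b)) + ∑∑ N (λ d x → R (+ suc d) * φ (suc d ℕ.* suc x))
    reflection-identity = begin
      quadruples N φ h + _                             ≡⟨ cong₂ _+_ split-xy (sym D₂-sum) ⟩
      D₁ + (K + K) + D₂                            ≡⟨ lemma D₁ (K + K) D₂ ⟩
      D₂ + (K + K) + D₁                            ≡⟨ cong₂ _+_ (sym split-ab) D₁-sum ⟩
      quadruples N φ (λ a b → h a (- b)) + _           ∎
      where
      lemma : ∀ a b c → a + b + c ≡ c + b + a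
      lemma = solve-∀

  quadruples-cong : ∀ N φ {f g : ℤ → ℤ → ℤ} → (∀ a b → f a b ≡ g a b) → quadruples N φ f ≡
    quadruples N φ g
  quadruples-cong N φ f≗g = ∑∑-cong N λ a b → ∑∑-cong N λ x y →
    cong (_* φ _) (f≗g (+ suc a) (+ suc b))

  quadruples-+ : ∀ N φ (f g : ℤ → ℤ → ℤ) →
    quadruples N φ (λ a b → f a b + g a b) ≡ quadruples N φ f + quadruples N φ g
  quadruples-+ N φ f g = trans
    (∑∑-cong N λ a b → trans
      (∑∑-cong N λ x y → ℤ.*-distribʳ-+ (φ _) (f (+ suc a) (+ suc b)) (g (+ suc a) (+ suc b)))
      (∑∑-+ N _ _))
    (∑∑-+ N _ _)

  quadruples-*ˡ : ∀ N φ c (f : ℤ → ℤ → ℤ) →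
    quadruples N φ (λ a b → c * f a b) ≡ c * quadruples N φ f
  quadruples-*ˡ N φ c f = trans
    (∑∑-cong N λ a b → trans
      (∑∑-cong N λ x y → ℤ.*-assoc c (f (+ suc a) (+ suc b)) (φ _))
      (∑∑-*ˡ N c _))
    (∑∑-*ˡ N c _)

  -- Up to q^N, this is the series of w(a) q^a / (1 - q^a) over a ≥ 1; its coefficient at n, for 1 ≤
  -- n ≤ N, is the sum of w over the divisors of n.
  lambert : ℕ → (ℤ → ℤ) → Series
  lambert N w n = ∑∑ N λ a x → w (+ suc a) * mono (suc a ℕ.* suc x) n

  lambert-⊛ : ∀ N w v n →
    (lambert N w ⊛ lambert N v) n ≡ quadruples N (λ m → mono m n) (λ a b → w a * v b)
  lambert-⊛ N w v n = begin
    (lambert N w ⊛ lambert N v) n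
      ≡⟨ ⊛-∑ˡ N _ _ n ⟩
    ∑ N (λ a → ((λ i → ∑ N (λ x → W a x i)) ⊛ lambert N v) n)
      ≡⟨ ∑-cong N (λ a → ⊛-∑ˡ N (W a) _ n) ⟩
    ∑∑ N (λ a x → (W a x ⊛ lambert N v) n)
      ≡⟨ ∑∑-cong N (λ a x → trans (⊛-∑ʳ N (W a x) _ n) (∑-cong N (λ b → ⊛-∑ʳ N (W a x) (V b) n))) ⟩
    ∑∑ N (λ a x → ∑∑ N (λ b y → (W a x ⊛ V b y) n))
      ≡⟨ ∑∑-cong N (λ a x → ∑∑-cong N (λ b y → monomials (w (+ suc a)) (v (+ suc b))
        (suc a ℕ.* suc x) (suc b ℕ.* suc y))) ⟩
    ∑∑ N (λ a x → ∑∑ N (λ b y →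
      w (+ suc a) * v (+ suc b) * mono (suc a ℕ.* suc x ℕ.+ suc b ℕ.* suc y) n))
      ≡⟨ ∑-cong N (λ a → ∑-swap N N _) ⟩
    quadruples N (λ m → mono m n) (λ a b → w a * v b)
      ∎
    where
    W V : ℕ → ℕ → Series
    W a x i = w (+ suc a) * mono (suc a ℕ.* suc x) i
    V b y i = v (+ suc b) * mono (suc b ℕ.* suc y) i
    monomials : ∀ c d k l →
      ((λ i → c * mono k i) ⊛ (λ i → d * mono l i)) n ≡ c * d * mono (k ℕ.+ l) n
    monomials c d k l = begin
      ((λ i → c * mono k i) ⊛ (λ i → d * mono l i)) n ≡⟨ ⊛-scaleˡ c (mono k) _ n ⟩
      c * (mono k ⊛ (λ i → d * mono l i)) n           ≡⟨ cong (c *_) (⊛-scaleʳ d (mono k) (mono l) n) ⟩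
      c * (d * (mono k ⊛ mono l) n)                   ≡⟨ ℤ.*-assoc c d _ ⟨
      c * d * (mono k ⊛ mono l) n                     ≡⟨ cong (c * d *_) (mono-⊛ k l n) ⟩
      c * d * mono (k ℕ.+ l) n                        ∎

  lambert-cong : ∀ N {w v : ℤ → ℤ} → (∀ a → w a ≡ v a) → ∀ n → lambert N w n ≡ lambert N v n
  lambert-cong N w≗v n = ∑∑-cong N λ a x → cong (_* mono (suc a ℕ.* suc x) n) (w≗v (+ suc a))

  lambert-+ : ∀ N w v n → lambert N (λ a → w a + v a) n ≡ lambert N w n + lambert N v n
  lambert-+ N w v n = trans
    (∑∑-cong N λ a x → ℤ.*-distribʳ-+ (mono (suc a ℕ.* suc x) n) (w (+ suc a)) (v (+ suc a)))
    (∑∑-+ N _ _)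

  lambert-*ˡ : ∀ N c w n → lambert N (λ a → c * w a) n ≡ c * lambert N w n
  lambert-*ˡ N c w n = trans
    (∑∑-cong N λ a x → ℤ.*-assoc c (w (+ suc a)) (mono (suc a ℕ.* suc x) n))
    (∑∑-*ˡ N c _)

  -- On the support n = a (u + 1). Splitting off the 1 leaves the multiplicity u that the diagonal a
  -- = b has in `reflection-identity`.
  θ-lambert : ∀ N w n →
    θ (lambert N w) n
      ≡ ∑∑ N (λ a u → + u * (+ suc a * w (+ suc a)) * mono (suc a ℕ.* suc u) n)
        + lambert N (λ a → a * w a) n
  θ-lambert N w n = begin
    + n * lambert N w n
      ≡⟨ ∑∑-*ˡ N (+ n) _ ⟨
    ∑∑ N (λ a u → + n * (w (+ suc a) * mono (suc a ℕ.* suc u) n))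
      ≡⟨ ∑∑-cong N (λ a u → trans
           (swap (+ n) (w (+ suc a)) _)
           (trans (cong (w (+ suc a) *_) (sym (mono-support (suc a ℕ.* suc u) n (λ k → + k))))
           (trans (cong (λ k → w (+ suc a) * (k * mono (suc a ℕ.* suc u) n)) (ℤ.pos-* (suc a) (suc u)))
                  (expand (+ suc a) (+ u) (w (+ suc a)) _)))) ⟩
    ∑∑ N (λ a u → + u * (+ suc a * w (+ suc a)) * mono (suc a ℕ.* suc u) n
                + + suc a * w (+ suc a) * mono (suc a ℕ.* suc u) n)
      ≡⟨ ∑∑-+ N _ _ ⟩
    ∑∑ N (λ a u → + u * (+ suc a * w (+ suc a)) * mono (suc a ℕ.* suc u) n)
      + lambert N (λ a → a * w a) n
      ∎
    where
    swap : ∀ a b c → a * (b * c) ≡ b * (a * c)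
    swap = solve-∀
    expand : ∀ a u c e → c * (a * (1ℤ + u) * e) ≡ u * (a * c) * e + a * c * e
    expand = solve-∀

  mono-vanish : ∀ {N n} → n ℕ.≤ N → ∀ {m} → N ℕ.< m → mono m n ≡ 0ℤ
  mono-vanish n≤N N<m = mono-off (ℕ.>⇒≢ (ℕ.≤-<-trans n≤N N<m))

  -- Weights are kept as solver expressions, so that one definition serves both as a function on ℤ
  -- and as input to `solve`.
  ⟦_⟧₁ : (Polynomial 1 → Polynomial 1) → ℤ → ℤ
  ⟦ p ⟧₁ a = ⟦ p (var zero) ⟧ (a ∷ [])

  ⟦_⟧₂ : (Polynomial 2 → Polynomial 2 → Polynomial 2) → ℤ → ℤ → ℤ
  ⟦ p ⟧₂ a b = ⟦ p (var zero) (var (suc zero)) ⟧ (a ∷ b ∷ [])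

  private
    variable
      k : ℕ

  cube fifth : Polynomial k → Polynomial k
  cube a = a :* a :* a
  fifth a = a :* a :* a :* a :* a

  S₁ S₃ S₅ : ℕ → Series
  S₁ N = lambert N (λ a → a)
  S₃ N = lambert N ⟦ cube ⟧₁
  S₅ N = lambert N ⟦ fifth ⟧₁

  module _ (N : ℕ) {n : ℕ} (n≤N : n ℕ.≤ N) where

    private
      φ : ℕ → ℤ
      φ m = mono m n
      Q = quadruples N φ

    doubled : ∀ w v → Q (λ a b → w a * v b + v a * w b) ≡ + 2 * (lambert N w ⊛ lambert N v) n
    doubled w v = begin
      Q (λ a b → w a * v b + v a * w b)
        ≡⟨ quadruples-+ N φ (λ a b → w a * v b) (λ a b → v a * w b) ⟩
      Q (λ a b → w a * v b) + Q (λ a b → v a * w b)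
        ≡⟨ cong₂ _+_ (sym (lambert-⊛ N w v n))
          (trans (sym (lambert-⊛ N v w n)) (⊛-comm (lambert N v) (lambert N w) n)) ⟩
      (lambert N w ⊛ lambert N v) n + (lambert N w ⊛ lambert N v) n
        ≡⟨ double ((lambert N w ⊛ lambert N v) n) ⟩
      + 2 * (lambert N w ⊛ lambert N v) n ∎
      where
      double : ∀ x → x + x ≡ + 2 * x
      double = solve-∀

    module Reflection
      (h : ℤ → ℤ → ℤ)
      (h-sym  : ∀ a b → h a b ≡ h b a)
      (h-rotʳ : ∀ a b → h a (- (a + b)) ≡ h a b)
      (h-rotˡ : ∀ a b → h (a + b) (- a) ≡ h a b)
      (R : ℤ → ℤ) (R-sum : ∀ d → ∑ d (λ a → h (+ suc a) (- + suc d)) ≡ R (+ suc d))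
      (odd : ℤ → ℤ → ℤ) (h-odd : ∀ a b → h a b ≡ h a (- b) + odd a b)
      (w : ℤ → ℤ) (h-diag : ∀ a → h a (- a) ≡ a * w a)
      where

      open SymmetricTriples N φ (mono-vanish n≤N) h h-sym h-rotʳ h-rotˡ R R-sum

      -- Cancelling the sum of h(a, -b) in `reflection-identity` leaves the odd part. The diagonal a
      -- = b is the derivative of `lambert N w` short of the sum of a w(a), which moves to the
      -- right-hand side.
      sum-odd : Q odd + θ (lambert N w) n ≡ lambert N (λ d → R d + d * w d) n
      sum-odd = +-cancelˡ (Q h⁻) _ _ (begin
        Q h⁻ + (Q odd + θ (lambert N w) n)
          ≡⟨ cong₂ _+_ {x = Q h⁻} refl (cong₂ _+_ {x = Q odd} refl (trans (θ-lambert N w n)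
               (cong (_+ L) (∑∑-cong N λ a u → cong (λ e → + u * e * φ (suc a ℕ.* suc u))
                 (sym (h-diag (+ suc a))))))) ⟩
        Q h⁻ + (Q odd + (D + L))
          ≡⟨ assoc (Q h⁻) (Q odd) D L ⟩
        Q h⁻ + Q odd + D + L
          ≡⟨ cong (λ s → s + D + L) (trans (quadruples-cong N φ h-odd) (quadruples-+ N φ h⁻ odd)) ⟨
        Q h + D + L
          ≡⟨ cong (_+ L) reflection-identity ⟩
        Q h⁻ + lambert N R n + L
          ≡⟨ trans (ℤ.+-assoc (Q h⁻) _ _) (cong₂ _+_ {x = Q h⁻} refl
            (sym (lambert-+ N R (λ a → a * w a) n))) ⟩
        Q h⁻ + lambert N (λ d → R d + d * w d) n
          ∎)
        where
        h⁻ : ℤ → ℤ → ℤ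
        h⁻ a b = h a (- b)
        L D : ℤ
        L = lambert N (λ a → a * w a) n
        D = ∑∑ N λ a u → + u * h (+ suc a) (- + suc a) * φ (suc a ℕ.* suc u)
        assoc : ∀ a b c d → a + (b + (c + d)) ≡ a + b + c + d
        assoc = solve-∀

  -- Minus the second elementary symmetric function of a, b and -(a + b); hence the invariance.
  norm : (a b : Polynomial k) → Polynomial k
  norm a b = a :* a :+ a :* b :+ b :* b

  -- The differential equation of E₄.

  module Weight₄ where

    -- The square of `norm` is the invariant of degree 4; 30 is the denominator of the sum of fourth
    -- powers.
    H odd : (a b : Polynomial k) → Polynomial k
    H a b = con (+ 30) :* (norm a b :* norm a b)
    odd a b = con (+ 120) :* (a :* cube b :+ cube a :* b)

    -- The last term is the endpoint H(d, -d), missing from a sum over a < d; `sum-odd` adds it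
    -- back, and only odd powers of d remain.
    R : Polynomial k → Polynomial k
    R d = con (+ 21) :* fifth d :+ con (+ 10) :* cube d :- d :- d :* (con (+ 30) :* cube d)

    -- Faulhaber's formulas applied to the powers of a in H(a, -d). Keeping m independent of d makes
    -- the induction on m possible; `R` is the case m = d - 1.
    F : (d m : Polynomial k) → Polynomial k
    F d m =
      m :* (con 1ℤ :+ m) :* (con (+ 2) :* m :+ con 1ℤ) :*
        (con (+ 3) :* (m :* m) :+ con (+ 3) :* m :- con 1ℤ)
      :- con (+ 15) :* (m :* m :* ((con 1ℤ :+ m) :* (con 1ℤ :+ m)) :* d)
      :+ con (+ 15) :* (m :* (con 1ℤ :+ m) :* (con (+ 2) :* m :+ con 1ℤ) :* (d :* d))
      :- con (+ 30) :* (m :* (con 1ℤ :+ m) :* cube d)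
      :+ con (+ 30) :* (m :* (d :* cube d))

    partial-sum : ∀ d m → ∑ m (λ a → ⟦ H ⟧₂ (+ suc a) (- d)) ≡ ⟦ F ⟧₂ d (+ m)
    partial-sum d zero    = solve 1 (λ d → con 0ℤ := F d (con 0ℤ)) refl d
    partial-sum d (suc m) = trans (cong (_+ ⟦ H ⟧₂ (+ suc m) (- d)) (partial-sum d m))
      (solve 2 (λ d m → F d m :+ H (con 1ℤ :+ m) (:- d) := F d (con 1ℤ :+ m)) refl d (+ m))

    R-sum : ∀ d → ∑ d (λ a → ⟦ H ⟧₂ (+ suc a) (- + suc d)) ≡ ⟦ R ⟧₁ (+ suc d)
    R-sum d = trans (partial-sum (+ suc d) d)
      (solve 1 (λ d → F (con 1ℤ :+ d) d := R (con 1ℤ :+ d)) refl (+ d))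

    -- Equivalent to 3 θ E₄ = E₂ E₄ - E₆.
    identity : ∀ N {n} → n ℕ.≤ N →
      + 240 * (S₁ N ⊛ S₃ N) n + + 30 * θ (S₃ N) n + S₁ N n ≡ + 21 * S₅ N n + + 10 * S₃ N n
    identity N {n} n≤N = begin
      + 240 * (S₁ N ⊛ S₃ N) n + + 30 * θ (S₃ N) n + S₁ N n
        ≡⟨ regroup ((S₁ N ⊛ S₃ N) n) (+ n) (S₃ N n) (S₁ N n) ⟩
      + 120 * (+ 2 * (S₁ N ⊛ S₃ N) n) + + n * (+ 30 * S₃ N n) + S₁ N n
        ≡⟨ cong₂ (λ s t → + 120 * s + + n * t + S₁ N n) (doubled N n≤N (λ a → a) ⟦ cube ⟧₁)
          (lambert-*ˡ N (+ 30) ⟦ cube ⟧₁ n) ⟨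
      + 120 * Q (λ a b → a * ⟦ cube ⟧₁ b + ⟦ cube ⟧₁ a * b) + θ (lambert N w) n + S₁ N n
        ≡⟨ cong (λ s → s + θ (lambert N w) n + S₁ N n)
             (quadruples-*ˡ N φ (+ 120) (λ a b → a * ⟦ cube ⟧₁ b + ⟦ cube ⟧₁ a * b)) ⟨
      Q ⟦ odd ⟧₂ + θ (lambert N w) n + S₁ N n
        ≡⟨ cong (_+ S₁ N n) sum-odd ⟩
      lambert N (λ d → ⟦ R ⟧₁ d + d * w d) n + S₁ N n
        ≡⟨ lambert-+ N (λ d → ⟦ R ⟧₁ d + d * w d) (λ d → d) n ⟨
      lambert N (λ d → ⟦ R ⟧₁ d + d * w d + d) n
        ≡⟨ lambert-cong N (solve 1 (λ d → R d :+ d :* (con (+ 30) :* cube d) :+ d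
             := con (+ 21) :* fifth d :+ con (+ 10) :* cube d) refl) n ⟩
      lambert N (λ d → + 21 * ⟦ fifth ⟧₁ d + + 10 * ⟦ cube ⟧₁ d) n
        ≡⟨ trans (lambert-+ N (λ d → + 21 * ⟦ fifth ⟧₁ d) (λ d → + 10 * ⟦ cube ⟧₁ d) n)
                 (cong₂ _+_ (lambert-*ˡ N (+ 21) ⟦ fifth ⟧₁ n) (lambert-*ˡ N (+ 10) ⟦ cube ⟧₁ n)) ⟩
      + 21 * S₅ N n + + 10 * S₃ N n
        ∎
      where
      φ : ℕ → ℤ
      φ m = mono m n
      Q : (ℤ → ℤ → ℤ) → ℤ
      Q = quadruples N φ
      w : ℤ → ℤ
      w a = + 30 * ⟦ cube ⟧₁ a
      open Reflection N n≤N ⟦ H ⟧₂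
        (solve 2 (λ a b → H a b := H b a) refl)
        (solve 2 (λ a b → H a (:- (a :+ b)) := H a b) refl)
        (solve 2 (λ a b → H (a :+ b) (:- a) := H a b) refl)
        ⟦ R ⟧₁ R-sum
        ⟦ odd ⟧₂ (solve 2 (λ a b → H a b := H a (:- b) :+ odd a b) refl)
        w (solve 1 (λ a → H a (:- a) := a :* (con (+ 30) :* cube a)) refl)
      regroup : ∀ x n y z → + 240 * x + + 30 * (n * y) + z ≡ + 120 * (+ 2 * x) + n * (+ 30 * y) + z
      regroup = solve-∀

  -- The differential equation of E₆.

  module Weight₆ where

    -- The invariants of weight 6 are spanned by norm³ and t²; the coefficients 42 and -747 are those
    -- for which products of Lambert series appear as they do in E₂ E₆ - E₄².
    t G H odd : (a b : Polynomial k) → Polynomial k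
    t a b = a :* b :* (a :+ b)
    G x y = con (+ 42) :* (x :* x :* x) :- con (+ 747) :* (y :* y)
    H a b = G (norm a b) (t a b)
    odd a b = con (+ 252) :* (a :* fifth b :+ fifth a :* b) :+ con (- + 2400) :* (cube a :* cube b)

    R : Polynomial k → Polynomial k
    R d = con (+ 21) :* fifth d :+ con (+ 20) :* cube d :+ d :- d :* (con (+ 42) :* fifth d)

    F : (d m : Polynomial k) → Polynomial k
    F d m =
      con (+ 2) :* (s :* (con (+ 2) :* m :+ con 1ℤ) :*
        (con (+ 3) :* (m :* cube m) :+ con (+ 6) :* cube m :- con (+ 3) :* m :+ con 1ℤ))
      :- con (+ 21) :* (s :* s :* (con (+ 2) :* (m :* m) :+ con (+ 2) :* m :- con 1ℤ) :* d)
      :- con (+ 33) :* (s :* (con (+ 2) :* m :+ con 1ℤ) :*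
        (con (+ 3) :* (m :* m) :+ con (+ 3) :* m :- con 1ℤ) :* (d :* d))
      :+ con (+ 600) :* (s :* s :* cube d)
      :- con (+ 165) :* (s :* (con (+ 2) :* m :+ con 1ℤ) :* (d :* cube d))
      :- con (+ 126) :* (s :* fifth d)
      :+ con (+ 84) :* (m :* (d :* fifth d))
      where
      s = m :* (con 1ℤ :+ m)

    -- The factor 2 clears the denominators of the sums of powers.
    partial-sum : ∀ d m → + 2 * ∑ m (λ a → ⟦ H ⟧₂ (+ suc a) (- d)) ≡ ⟦ F ⟧₂ d (+ m)
    partial-sum d zero    = solve 1 (λ d → con 0ℤ := F d (con 0ℤ)) refl d
    partial-sum d (suc m) = trans (ℤ.*-distribˡ-+ (+ 2) (∑ m (λ a → ⟦ H ⟧₂ (+ suc a) (- d)))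
      (⟦ H ⟧₂ (+ suc m) (- d)))
      (trans (cong (_+ + 2 * ⟦ H ⟧₂ (+ suc m) (- d)) (partial-sum d m))
        (solve 2 (λ d m → F d m :+ con (+ 2) :* H (con 1ℤ :+ m) (:- d) := F d (con 1ℤ :+ m)) refl d
          (+ m)))

    R-sum : ∀ d → ∑ d (λ a → ⟦ H ⟧₂ (+ suc a) (- + suc d)) ≡ ⟦ R ⟧₁ (+ suc d)
    R-sum d = ℤ.*-cancelˡ-≡ (+ 2) _ _ (trans (partial-sum (+ suc d) d)
      (solve 1 (λ d → F (con 1ℤ :+ d) d := con (+ 2) :* R (con 1ℤ :+ d)) refl (+ d)))

    H-odd : ∀ a b → ⟦ H ⟧₂ a b ≡ ⟦ H ⟧₂ a (- b) + ⟦ odd ⟧₂ a b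
    H-odd = solve 2 (λ a b → H a b := H a (:- b) :+ odd a b) refl

    H-diag : ∀ a → ⟦ H ⟧₂ a (- a) ≡ a * (+ 42 * ⟦ fifth ⟧₁ a)
    H-diag = solve 1 (λ a → H a (:- a) := a :* (con (+ 42) :* fifth a)) refl

    -- Explicit arguments keep the unifier from unfolding the polynomials.
    G-cong : ∀ x x′ y y′ → x ≡ x′ → y ≡ y′ → ⟦ G ⟧₂ x y ≡ ⟦ G ⟧₂ x′ y′
    G-cong x x′ y y′ refl refl = refl

    -- Invariance is checked on the generators `norm` and `t`, of degree 2 and 3, instead of on the
    -- expanded sextic.
    H-sym : ∀ a b → ⟦ H ⟧₂ a b ≡ ⟦ H ⟧₂ b a
    H-sym a b = G-cong (⟦ norm ⟧₂ a b) (⟦ norm ⟧₂ b a) (⟦ t ⟧₂ a b) (⟦ t ⟧₂ b a)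
      (solve 2 (λ a b → norm a b := norm b a) refl a b)
      (solve 2 (λ a b → t a b := t b a) refl a b)

    H-rotʳ : ∀ a b → ⟦ H ⟧₂ a (- (a + b)) ≡ ⟦ H ⟧₂ a b
    H-rotʳ a b = G-cong (⟦ norm ⟧₂ a (- (a + b))) (⟦ norm ⟧₂ a b) (⟦ t ⟧₂ a (- (a + b))) (⟦ t ⟧₂ a b)
      (solve 2 (λ a b → norm a (:- (a :+ b)) := norm a b) refl a b)
      (solve 2 (λ a b → t a (:- (a :+ b)) := t a b) refl a b)

    H-rotˡ : ∀ a b → ⟦ H ⟧₂ (a + b) (- a) ≡ ⟦ H ⟧₂ a b
    H-rotˡ a b = trans
      (G-cong (⟦ norm ⟧₂ (a + b) (- a)) (⟦ norm ⟧₂ a b) (⟦ t ⟧₂ (a + b) (- a)) (- ⟦ t ⟧₂ a b)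
        (solve 2 (λ a b → norm (a :+ b) (:- a) := norm a b) refl a b)
        (solve 2 (λ a b → t (a :+ b) (:- a) := :- t a b) refl a b))
      (solve 2 (λ x y → G x (:- y) := G x y) refl (⟦ norm ⟧₂ a b) (⟦ t ⟧₂ a b))

    -- Equivalent to 2 θ E₆ = E₂ E₆ - E₄².
    identity : ∀ N {n} → n ℕ.≤ N →
      + 504 * (S₁ N ⊛ S₅ N) n + - + 2400 * (S₃ N ⊛ S₃ N) n + + 42 * θ (S₅ N) n
        ≡ + 21 * S₅ N n + + 20 * S₃ N n + S₁ N n
    identity N {n} n≤N = begin
      + 504 * (S₁ N ⊛ S₅ N) n + - + 2400 * (S₃ N ⊛ S₃ N) n + + 42 * θ (S₅ N) n
        ≡⟨ regroup ((S₁ N ⊛ S₅ N) n) ((S₃ N ⊛ S₃ N) n) (+ n) (S₅ N n) ⟩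
      + 252 * (+ 2 * (S₁ N ⊛ S₅ N) n) + - + 2400 * (S₃ N ⊛ S₃ N) n + + n * (+ 42 * S₅ N n)
        ≡⟨ cong₂ _+_
             (cong₂ (λ s t → + 252 * s + - + 2400 * t)
               (doubled N n≤N (λ a → a) ⟦ fifth ⟧₁) (sym (lambert-⊛ N ⟦ cube ⟧₁ ⟦ cube ⟧₁ n)))
             (cong (λ t → + n * t) (lambert-*ˡ N (+ 42) ⟦ fifth ⟧₁ n)) ⟨
      + 252 * Q odd₁₅ + - + 2400 * Q odd₃₃ + θ (lambert N w) n
        ≡⟨ cong (_+ θ (lambert N w) n) (trans
          (quadruples-+ N φ (λ a b → + 252 * odd₁₅ a b) (λ a b → - + 2400 * odd₃₃ a b))
             (cong₂ _+_ (quadruples-*ˡ N φ (+ 252) odd₁₅) (quadruples-*ˡ N φ (- + 2400) odd₃₃))) ⟨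
      Q ⟦ odd ⟧₂ + θ (lambert N w) n
        ≡⟨ sum-odd ⟩
      lambert N (λ d → ⟦ R ⟧₁ d + d * w d) n
        ≡⟨ lambert-cong N (solve 1 (λ d → R d :+ d :* (con (+ 42) :* fifth d)
             := con (+ 21) :* fifth d :+ con (+ 20) :* cube d :+ d) refl) n ⟩
      lambert N (λ d → + 21 * ⟦ fifth ⟧₁ d + + 20 * ⟦ cube ⟧₁ d + d) n
        ≡⟨ lambert-+ N (λ d → + 21 * ⟦ fifth ⟧₁ d + + 20 * ⟦ cube ⟧₁ d) (λ d → d) n ⟩
      lambert N (λ d → + 21 * ⟦ fifth ⟧₁ d + + 20 * ⟦ cube ⟧₁ d) n + S₁ N n
        ≡⟨ cong (_+ S₁ N n) (trans (lambert-+ N (λ d → + 21 * ⟦ fifth ⟧₁ d)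
          (λ d → + 20 * ⟦ cube ⟧₁ d) n)
                 (cong₂ _+_ (lambert-*ˡ N (+ 21) ⟦ fifth ⟧₁ n) (lambert-*ˡ N (+ 20) ⟦ cube ⟧₁ n))) ⟩
      + 21 * S₅ N n + + 20 * S₃ N n + S₁ N n
        ∎
      where
      φ : ℕ → ℤ
      φ m = mono m n
      Q : (ℤ → ℤ → ℤ) → ℤ
      Q = quadruples N φ
      w : ℤ → ℤ
      w a = + 42 * ⟦ fifth ⟧₁ a
      odd₁₅ odd₃₃ : ℤ → ℤ → ℤ
      odd₁₅ a b = a * ⟦ fifth ⟧₁ b + ⟦ fifth ⟧₁ a * b
      odd₃₃ a b = ⟦ cube ⟧₁ a * ⟦ cube ⟧₁ b
      open Reflection N n≤N ⟦ H ⟧₂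
        H-sym H-rotʳ H-rotˡ
        ⟦ R ⟧₁ R-sum
        ⟦ odd ⟧₂ H-odd w H-diag
      regroup : ∀ x z n y →
        + 504 * x + - + 2400 * z + + 42 * (n * y) ≡ + 252 * (+ 2 * x) + - + 2400 * z + n * (+ 42 * y)
      regroup = solve-∀

open LambertSeries

-- Commutative rings with integer scalars.

Scalars : ∀ {c ℓ} → CommutativeRing c ℓ → Set (c ⊔ ℓ)
Scalars R = CommutativeRing.rawRing ℤ.+-*-commutativeRing -Raw-AlmostCommutative⟶ fromCommutativeRing R

module IntegerAlgebra {c ℓ} (R : CommutativeRing c ℓ) (scalars : Scalars R) where

  open CommutativeRing R public
  open _-Raw-AlmostCommutative⟶_ scalars public renaming (⟦_⟧ to κ)
  open Exp commutativeSemiring public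
  open import Relation.Binary.Reasoning.Setoid setoid public

  module Solver = RingSolver _ (fromCommutativeRing R) scalars
    (λ a b → Maybe.map (λ a≡b → reflexive (≡.cong κ a≡b)) (dec⇒maybe (a ℤ.≟ b)))

  ∏ : ℕ → (ℕ → Carrier) → Carrier
  ∏ zero    f = 1#
  ∏ (suc n) f = ∏ n f * f n

  ∏-cong : ∀ n {f g} → (∀ i → f i ≈ g i) → ∏ n f ≈ ∏ n g
  ∏-cong zero    f≈g = refl
  ∏-cong (suc n) f≈g = *-cong (∏-cong n f≈g) (f≈g n)

  ∏-^ : ∀ n f k → ∏ n (λ i → f i ^ k) ≈ ∏ n f ^ k
  ∏-^ zero    f k = sym (1^ k)
    where
    1^ : ∀ k → 1# ^ k ≈ 1#
    1^ zero    = refl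
    1^ (suc k) = trans (*-identityˡ _) (1^ k)
  ∏-^ (suc n) f k = trans (*-congʳ (∏-^ n f k)) (sym (^-distrib-* (∏ n f) (f n) k))

  ∏-inverse : ∀ n {f g} → (∀ i → f i * g i ≈ 1#) → ∏ n f * ∏ n g ≈ 1#
  ∏-inverse zero    fg≈1 = *-identityˡ 1#
  ∏-inverse (suc n) {f} {g} fg≈1 = begin
    ∏ n f * f n * (∏ n g * g n)
      ≈⟨ solve 4 (λ a b c d → a :* b :* (c :* d) := a :* c :* (b :* d)) refl _ _ _ _ ⟩
    ∏ n f * ∏ n g * (f n * g n)   ≈⟨ *-cong (∏-inverse n fg≈1) (fg≈1 n) ⟩
    1# * 1#                       ≈⟨ *-identityˡ 1# ⟩
    1#                            ∎
    where open Solver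

  ∏-drop : ∀ m n {f} → (∀ i → m ℕ.≤ i → f i ≈ 1#) → ∏ (m ℕ.+ n) f ≈ ∏ m f
  ∏-drop m zero    {f} f≈1 = reflexive (≡.cong (λ k → ∏ k f) (ℕ.+-identityʳ m))
  ∏-drop m (suc n) {f} f≈1 = trans (reflexive (≡.cong (λ k → ∏ k f) (ℕ.+-suc m n)))
    (trans (*-cong (∏-drop m n f≈1) (f≈1 (m ℕ.+ n) (ℕ.m≤m+n m n))) (*-identityʳ _))

-- Derivations and the discriminant.

module Derivation {c ℓ} (R : CommutativeRing c ℓ) (scalars : Scalars R) where

  open IntegerAlgebra R scalars

  record IsDerivation (θ : Carrier → Carrier) : Set (c ⊔ ℓ) where
    field
      θ-cong : ∀ {x y} → x ≈ y → θ x ≈ θ y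
      θ-+    : ∀ x y → θ (x + y) ≈ θ x + θ y
      θ-*    : ∀ x y → θ (x * y) ≈ θ x * y + x * θ y
      θ-κ    : ∀ n → θ (κ n) ≈ 0#

  module _ {θ : Carrier → Carrier} (isDerivation : IsDerivation θ) where
    open IsDerivation isDerivation
    open Solver

    θ-1 : θ 1# ≈ 0#
    θ-1 = trans (θ-cong (sym 1-homo)) (θ-κ 1ℤ)

    θ-scale : ∀ n x → θ (κ n * x) ≈ κ n * θ x
    θ-scale n x = trans (θ-* (κ n) x) (trans (+-congʳ (trans (*-congʳ (θ-κ n)) (zeroˡ x)))
      (+-identityˡ _))

    -- The hypothesis says that x has logarithmic derivative l, without dividing by x. A power
    -- multiplies it by the exponent; in `θ-∏` a product adds it up.
    θ-^ : ∀ {l x} → θ x ≈ l * x → ∀ n → θ (x ^ n) ≈ κ (+ n) * l * x ^ n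
    θ-^ {l} {x} θx zero    = trans θ-1 (sym (trans (*-congʳ (trans (*-congʳ 0-homo) (zeroˡ l)))
      (zeroˡ _)))
    θ-^ {l} {x} θx (suc n) = begin
      θ (x * x ^ n)                                ≈⟨ θ-* x (x ^ n) ⟩
      θ x * x ^ n + x * θ (x ^ n)                  ≈⟨ +-cong (*-congʳ θx) (*-congˡ (θ-^ θx n)) ⟩
      l * x * x ^ n + x * (κ (+ n) * l * x ^ n)
        ≈⟨ solve 4 (λ l x y k → l :* x :* y :+ x :* (k :* l :* y) := (con 1ℤ :+ k) :* l :* (x :* y))
          refl l x (x ^ n) (κ (+ n)) ⟩
      (κ 1ℤ + κ (+ n)) * l * (x * x ^ n)           ≈⟨ *-congʳ (*-congʳ (sym (+-homo 1ℤ (+ n)))) ⟩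
      κ (+ suc n) * l * (x * x ^ n)                ∎

    ∑# : ℕ → (ℕ → Carrier) → Carrier
    ∑# zero    f = 0#
    ∑# (suc n) f = ∑# n f + f n

    θ-∏ : ∀ {l f} → (∀ i → θ (f i) ≈ l i * f i) → ∀ n → θ (∏ n f) ≈ ∑# n l * ∏ n f
    θ-∏ {l} {f} θf zero    = trans θ-1 (sym (zeroˡ 1#))
    θ-∏ {l} {f} θf (suc n) = begin
      θ (∏ n f * f n)                              ≈⟨ θ-* (∏ n f) (f n) ⟩
      θ (∏ n f) * f n + ∏ n f * θ (f n)            ≈⟨ +-cong (*-congʳ (θ-∏ θf n)) (*-congˡ (θf n)) ⟩
      ∑# n l * ∏ n f * f n + ∏ n f * (l n * f n)
        ≈⟨ solve 4 (λ s p l f → s :* p :* f :+ p :* (l :* f) := (s :+ l) :* (p :* f)) refl (∑# n l)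
          (∏ n f) (l n) (f n) ⟩
      (∑# n l + l n) * (∏ n f * f n)               ∎

    θ-neg : ∀ x → θ (- x) ≈ - θ x
    θ-neg x = begin
      θ (- x)          ≈⟨ θ-cong (solve 1 (λ x → :- x := con (ℤ.- 1ℤ) :* x) refl x) ⟩
      θ (κ (ℤ.- 1ℤ) * x) ≈⟨ θ-scale (ℤ.- 1ℤ) x ⟩
      κ (ℤ.- 1ℤ) * θ x ≈⟨ solve 1 (λ x → con (ℤ.- 1ℤ) :* x := :- x) refl (θ x) ⟩
      - θ x            ∎

    E : ℤ → Carrier → Carrier
    E n s = κ 1ℤ + κ n * s

    θ-E : ∀ n x → θ (E n x) ≈ κ n * θ x
    θ-E n x = trans (θ-+ (κ 1ℤ) (κ n * x)) (trans (+-cong (θ-κ 1ℤ) (θ-scale n x)) (+-identityˡ _))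

    module Eisenstein (s₁ s₃ s₅ : Carrier)
      (weight₄ : κ (+ 240) * (s₁ * s₃) + κ (+ 30) * θ s₃ + s₁ ≈ κ (+ 21) * s₅ + κ (+ 10) * s₃)
      (weight₆ : κ (+ 504) * (s₁ * s₅) + κ (ℤ.- + 2400) * (s₃ * s₃) + κ (+ 42) * θ s₅
               ≈ κ (+ 21) * s₅ + κ (+ 20) * s₃ + s₁)
      where

      E₂ E₄ E₆ : Carrier
      E₂ = E (ℤ.- + 24) s₁
      E₄ = E (+ 240) s₃
      E₆ = E (ℤ.- + 504) s₅

      discriminant : Carrier
      discriminant = E₄ * (E₄ * E₄) + - (E₆ * E₆)

      -- With 3 θ E₄ = E₂ E₄ - E₆ and 2 θ E₆ = E₂ E₆ - E₄², the derivative is E₄² (E₂ E₄ - E₆) - E₆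
      -- (E₂ E₆ - E₄²), in which the terms E₄² E₆ cancel.
      θ-discriminant : θ discriminant ≈ E₂ * discriminant
      θ-discriminant = begin
        θ discriminant
          ≈⟨ trans (θ-+ _ _) (+-cong (trans (θ-* _ _) (+-congˡ (*-congˡ (θ-* _ _))))
            (trans (θ-neg _) (-‿cong (θ-* _ _)))) ⟩
        θ E₄ * (E₄ * E₄) + E₄ * (θ E₄ * E₄ + E₄ * θ E₄) + - (θ E₆ * E₆ + E₆ * θ E₆)
          ≈⟨ +-cong (+-cong (*-congʳ e4) (*-congˡ (+-cong (*-congʳ e4) (*-congˡ e4))))
                    (-‿cong (+-cong (*-congʳ e6) (*-congˡ e6))) ⟩
        κ (+ 240) * θ s₃ * (E₄ * E₄) + E₄ * (κ (+ 240) * θ s₃ * E₄ + E₄ * (κ (+ 240) * θ s₃))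
          + - (κ (ℤ.- + 504) * θ s₅ * E₆ + E₆ * (κ (ℤ.- + 504) * θ s₅))
          -- Here `y` and `s₁` stand for E₄ and E₆. The equalities 3 * 240 = 24 * 30 and 2 * 504 =
          -- 24 * 42 expose the derivatives as they occur in `weight₄` and `weight₆`.
          ≈⟨ solve 5 (λ x y u s₁ s₃ →
               con (+ 240) :* x :* (y :* y) :+ y :* (con (+ 240) :* x :* y :+ y :* (con (+ 240) :* x))
               :+ :- (con (ℤ.- + 504) :* u :* s₁ :+ s₁ :* (con (ℤ.- + 504) :* u))
               := con (+ 24) :* (y :* y :* (con (+ 30) :* x) :+ s₁ :* (con (+ 42) :* u))) refl
                 (θ s₃) E₄ (θ s₅) E₆ s₃ ⟩
        κ (+ 24) * (E₄ * E₄ * (κ (+ 30) * θ s₃) + E₆ * (κ (+ 42) * θ s₅))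
          ≈⟨ *-congˡ (+-cong (*-congˡ w4) (*-congˡ w6)) ⟩
        κ (+ 24) * (E₄ * E₄ * (κ (+ 21) * s₅ + κ (+ 10) * s₃ + - (κ (+ 240) * (s₁ * s₃) + s₁))
          + E₆ * (κ (+ 21) * s₅ + κ (+ 20) * s₃ + s₁ + -
            (κ (+ 504) * (s₁ * s₅) + κ (ℤ.- + 2400) * (s₃ * s₃))))
          ≈⟨ solve 3 (λ s₁ s₃ s₅ → con (+ 24) :*
            (e′ (+ 240) s₃ :* e′ (+ 240) s₃ :*
              (con (+ 21) :* s₅ :+ con (+ 10) :* s₃ :+ :- (con (+ 240) :* (s₁ :* s₃) :+ s₁))
          :+ e′ (ℤ.- + 504) s₅ :* (con (+ 21) :* s₅ :+ con (+ 20) :* s₃ :+ s₁ :+ :-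
            (con (+ 504) :* (s₁ :* s₅) :+ con (ℤ.- + 2400) :* (s₃ :* s₃))))
            := e′ (ℤ.- + 24) s₁ :* (e′ (+ 240) s₃ :* (e′ (+ 240) s₃ :* e′ (+ 240) s₃) :+ :-
              (e′ (ℤ.- + 504) s₅ :* e′ (ℤ.- + 504) s₅))) refl s₁ s₃ s₅ ⟩
        E₂ * discriminant
          ∎
        where
        e′ : ∀ {k} → ℤ → Polynomial k → Polynomial k
        e′ n s = con 1ℤ :+ con n :* s
        e4 = θ-E (+ 240) s₃
        e6 = θ-E (ℤ.- + 504) s₅
        isolate : ∀ x y z → x + y ≈ z → y ≈ z + - x
        isolate x y z x+y≈z = trans (solve 2 (λ x y → y := x :+ y :+ :- x) refl x y) (+-congʳ x+y≈z)
        w4 = isolate (κ (+ 240) * (s₁ * s₃) + s₁) (κ (+ 30) * θ s₃) _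
          (trans (solve 3 (λ x y z → x :+ z :+ y := x :+ y :+ z) refl (κ (+ 240) * (s₁ * s₃))
            (κ (+ 30) * θ s₃) s₁) weight₄)
        w6 = isolate _ _ _ weight₆

-- Congruences modulo an integer.

module Modulo {c ℓ} (R : CommutativeRing c ℓ) (scalars : Scalars R) (d : ℤ) where

  open IntegerAlgebra R scalars
  open Solver

  infix 4 _≋_

  -- The quotient h is part of the data: for series, `θ` can be applied to it, and its coefficients
  -- witness divisibility in ℤ.
  _≋_ : Carrier → Carrier → Set (c ⊔ ℓ)
  x ≋ y = ∃ λ h → x ≈ y + κ d * h

  ≈⇒≋ : ∀ {x y} → x ≈ y → x ≋ y
  ≈⇒≋ x≈y = 0# , trans x≈y (trans (sym (+-identityʳ _)) (+-congˡ (sym (zeroʳ (κ d)))))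

  quotient : CommutativeRing c (c ⊔ ℓ)
  quotient = record
    { Carrier = Carrier
    ; _≈_     = _≋_
    ; _+_     = _+_
    ; _*_     = _*_
    ; -_      = -_
    ; 0#      = 0#
    ; 1#      = 1#
    ; isCommutativeRing = record
      { isRing = record
        { +-isAbelianGroup = record
          { isGroup = record
            { isMonoid = record
              { isSemigroup = record
                { isMagma = record
                  { isEquivalence = record
                    { refl  = ≈⇒≋ refl
                    ; sym   = λ {x} {y} (h , p) → - h , trans
                        (solve 3 (λ y d h → y := y :+ d :* h :+ d :* (:- h)) refl y (κ d) h)
                        (+-congʳ (sym p))
                    ; trans = λ {x} {y} {z} (h , p) (k , q) → k + h , trans p (trans (+-congʳ q)
                        (solve 4 (λ z d h k → z :+ d :* k :+ d :* h := z :+ d :* (k :+ h)) refl z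
                          (κ d) h k))
                    }
                  ; ∙-cong = λ {x} {y} {u} {v} (h , p) (k , q) → h + k , trans (+-cong p q)
                      (solve 5 (λ y v d h k → y :+ d :* h :+ (v :+ d :* k) := y :+ v :+ d :*
                        (h :+ k)) refl y v (κ d) h k)
                  }
                ; assoc = λ x y z → ≈⇒≋ (+-assoc x y z)
                }
              ; identity = (λ x → ≈⇒≋ (+-identityˡ x)) , (λ x → ≈⇒≋ (+-identityʳ x))
              }
            ; inverse = (λ x → ≈⇒≋ (-‿inverseˡ x)) , (λ x → ≈⇒≋ (-‿inverseʳ x))
            ; ⁻¹-cong = λ {x} {y} (h , p) → - h , trans (-‿cong p)
                (solve 3 (λ y d h → :- (y :+ d :* h) := :- y :+ d :* (:- h)) refl y (κ d) h)
            }
          ; comm = λ x y → ≈⇒≋ (+-comm x y)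
          }
        ; *-cong = λ {x} {y} {u} {v} (h , p) (k , q) → h * v + y * k + κ d * (h * k) , trans
          (*-cong p q)
            (solve 5 (λ y v d h k → (y :+ d :* h) :* (v :+ d :* k) := y :* v :+ d :*
              (h :* v :+ y :* k :+ d :* (h :* k)))
              refl y v (κ d) h k)
        ; *-assoc = λ x y z → ≈⇒≋ (*-assoc x y z)
        ; *-identity = (λ x → ≈⇒≋ (*-identityˡ x)) , (λ x → ≈⇒≋ (*-identityʳ x))
        ; distrib = (λ x y z → ≈⇒≋ (distribˡ x y z)) , (λ x y z → ≈⇒≋ (distribʳ x y z))
        }
      ; *-comm = λ x y → ≈⇒≋ (*-comm x y)
      }
    }

  quotientScalars : Scalars quotient
  quotientScalars = record
    { ⟦_⟧    = κ
    ; +-homo = λ a b → ≈⇒≋ (+-homo a b)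
    ; *-homo = λ a b → ≈⇒≋ (*-homo a b)
    ; -‿homo = λ a → ≈⇒≋ (-‿homo a)
    ; 0-homo = ≈⇒≋ 0-homo
    ; 1-homo = ≈⇒≋ 1-homo
    }

  κ-cong : ∀ {a b} → d ℤ.∣ a ℤ.- b → κ a ≋ κ b
  κ-cong {a} {b} (ℤ.divides q a-b≡qd) = κ q , (begin
    κ a                   ≡⟨ ≡.cong κ (≡.trans (restore a b) (≡.cong (λ e → b ℤ.+ e) a-b≡qd)) ⟩
    κ (b ℤ.+ q ℤ.* d)
      ≈⟨ trans (+-homo b (q ℤ.* d)) (+-congˡ (trans (*-homo q d) (*-comm (κ q) (κ d)))) ⟩
    κ b + κ d * κ q       ∎)
    where
    restore : ∀ a b → a ≡ b ℤ.+ (a ℤ.- b)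
    restore = solve-∀

  module QuotientSolver = RingSolver _ (fromCommutativeRing quotient) quotientScalars
    (λ a b → Maybe.map κ-cong (dec⇒maybe (d ℤ.∣? (a ℤ.- b))))

-- The Frobenius map and the discriminant modulo 5.

module ModuloFive {c ℓ} (R : CommutativeRing c ℓ) (scalars : Scalars R) where

  open Modulo R scalars (+ 5) public using (_≋_; ≈⇒≋; κ-cong)
  private module M = Modulo R scalars (+ 5)
  private module R = CommutativeRing R
  private module S = _-Raw-AlmostCommutative⟶_ scalars
  open IntegerAlgebra M.quotient M.quotientScalars
  open M.QuotientSolver

  -- The solver discards coefficients divisible by 5 but does not reduce the others, so that it has
  -- to be given a difference to compare with 0.
  by-difference : ∀ {x y} → x - y ≋ κ 0ℤ → x ≋ y
  by-difference {x} {y} p = x∙y⁻¹≈ε⇒x≈y x y (trans p 0-homo)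
    where open import Algebra.Properties.Group +-group using (x∙y⁻¹≈ε⇒x≈y)

  frobenius : ∀ x → (1# - x) ^ 5 ≋ 1# - x ^ 5
  frobenius x = begin
    (1# - x) ^ 5         ≈⟨ ^-congˡ 5 (+-congʳ (sym 1-homo)) ⟩
    (κ 1ℤ - x) ^ 5
      ≈⟨ by-difference (solve 1 (λ x → (con 1ℤ :- x) :^ 5 :- (con 1ℤ :- x :^ 5) := con 0ℤ) refl x) ⟩
    κ 1ℤ - x ^ 5         ≈⟨ +-congʳ 1-homo ⟩
    1# - x ^ 5           ∎

  frobenius² : ∀ x → (1# - x) ^ 25 ≋ 1# - x ^ 25
  frobenius² x = begin
    (1# - x) ^ 25        ≈⟨ ^-assocʳ (1# - x) 5 5 ⟨
    ((1# - x) ^ 5) ^ 5   ≈⟨ ^-congˡ 5 (frobenius x) ⟩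
    (1# - x ^ 5) ^ 5     ≈⟨ frobenius (x ^ 5) ⟩
    1# - (x ^ 5) ^ 5     ≈⟨ +-congˡ (-‿cong (^-assocʳ x 5 5)) ⟩
    1# - x ^ 25          ∎

  open Derivation R scalars using (IsDerivation; module IsDerivation)

  module _ {θ : R.Carrier → R.Carrier} (isDerivation : IsDerivation θ) where

    open Derivation R scalars using (θ-scale; module Eisenstein)
    open IsDerivation isDerivation

    θ-≋ : ∀ {x y} → x ≋ y → θ x ≋ θ y
    θ-≋ {x} {y} (h , p) = θ h ,
      R.trans (θ-cong p) (R.trans (θ-+ _ _) (R.+-congˡ (θ-scale isDerivation (+ 5) h)))

    module _ (s₁ s₃ s₅ : R.Carrier) (s₅≋s₁ : s₅ ≋ s₁)
      (weight₄ : R._≈_ (κ (+ 240) * (s₁ * s₃) + κ (+ 30) * θ s₃ + s₁) (κ (+ 21) * s₅ + κ (+ 10) * s₃))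
      (weight₆ : R._≈_ (κ (+ 504) * (s₁ * s₅) + κ (ℤ.- + 2400) * (s₃ * s₃) + κ (+ 42) * θ s₅)
                       (κ (+ 21) * s₅ + κ (+ 20) * s₃ + s₁))
      where
      open Eisenstein isDerivation s₁ s₃ s₅ weight₄ weight₆

      -- Modulo 5, E₄ ≡ 1 and E₆ ≡ 1 + s₅, so that twice the discriminant is s₅ + 3 s₅². By
      -- `weight₆` with s₁ ≡ s₅, the same polynomial is θ s₅.
      discriminant≋ : ∀ {y} → R._≈_ (κ (+ 1728) * y) discriminant → y ≋ θ s₁
      discriminant≋ {y} 1728y≈ = begin
        y
          -- 2 is inverse to 1728 ≡ 3 modulo 5.
          ≈⟨ by-difference (solve 1 (λ y → y :- (con (+ 2) :* (con (+ 1728) :* y)) := con 0ℤ) refl y) ⟩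
        κ (+ 2) * (κ (+ 1728) * y)
          ≈⟨ *-congˡ {κ (+ 2)} (≈⇒≋ 1728y≈) ⟩
        κ (+ 2) * discriminant
          ≈⟨ by-difference (solve 3 (λ s₁ s₃ s₅ → con (+ 2) :*
               ((con 1ℤ :+ con (+ 240) :* s₃) :*
                 ((con 1ℤ :+ con (+ 240) :* s₃) :* (con 1ℤ :+ con (+ 240) :* s₃))
                :+ :- ((con 1ℤ :+ con (ℤ.- + 504) :* s₅) :* (con 1ℤ :+ con (ℤ.- + 504) :* s₅))) :-
                  (s₅ :+ con (+ 3) :* (s₅ :* s₅)) := con 0ℤ) refl s₁ s₃ s₅) ⟩
        s₅ + κ (+ 3) * (s₅ * s₅)
          -- 3 is inverse to 42 ≡ 2. The multiples of 5 in s₃ are inserted to match `weight₆`, with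
          -- s₅ still in place of s₁.
          ≈⟨ by-difference (solve 2 (λ s₃ s₅ → s₅ :+ con (+ 3) :* (s₅ :* s₅) :-
            (con (+ 3) :* (con (+ 21) :* s₅ :+ con (+ 20) :* s₃ :+ s₅
                :- (con (+ 504) :* (s₅ :* s₅) :+ con (ℤ.- + 2400) :* (s₃ :* s₃)))) := con 0ℤ) refl
                  s₃ s₅) ⟩
        κ (+ 3) * (κ (+ 21) * s₅ + κ (+ 20) * s₃ + s₅ -
          (κ (+ 504) * (s₅ * s₅) + κ (ℤ.- + 2400) * (s₃ * s₃)))
          ≈⟨ *-congˡ {κ (+ 3)} (+-cong (+-congˡ s₅≋s₁)
            (-‿cong (+-congʳ (*-congˡ {κ (+ 504)} (*-congʳ {s₅} s₅≋s₁))))) ⟩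
        κ (+ 3) * (κ (+ 21) * s₅ + κ (+ 20) * s₃ + s₁ -
          (κ (+ 504) * (s₁ * s₅) + κ (ℤ.- + 2400) * (s₃ * s₃)))
          ≈⟨ *-congˡ {κ (+ 3)} (+-congʳ (≈⇒≋ weight₆)) ⟨
        κ (+ 3) * (κ (+ 504) * (s₁ * s₅) + κ (ℤ.- + 2400) * (s₃ * s₃) + κ (+ 42) * θ s₅
          - (κ (+ 504) * (s₁ * s₅) + κ (ℤ.- + 2400) * (s₃ * s₃)))
          ≈⟨ by-difference (solve 4 (λ s₁ s₃ s₅ t → con (+ 3) :*
            (con (+ 504) :* (s₁ :* s₅) :+ con (ℤ.- + 2400) :* (s₃ :* s₃) :+ con (+ 42) :* t
              :- (con (+ 504) :* (s₁ :* s₅) :+ con (ℤ.- + 2400) :* (s₃ :* s₃))) :- t := con 0ℤ) refl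
                s₁ s₃ s₅ (θ s₅)) ⟩
        θ s₅
          ≈⟨ θ-≋ s₅≋s₁ ⟩
        θ s₁
          ∎

  private module A = IntegerAlgebra R scalars

  ∏-≋ : ∀ n {f g} → (∀ i → f i ≋ g i) → A.∏ n f ≋ A.∏ n g
  ∏-≋ zero    f≋g = refl
  ∏-≋ (suc n) f≋g = *-cong (∏-≋ n f≋g) (f≋g n)

  frobenius-∏ : ∀ n (x : ℕ → R.Carrier) → A.∏ n (λ i → 1# - x i ^ 25) ≋ A.∏ n (λ i → 1# - x i) ^ 25
  frobenius-∏ n x = begin
    A.∏ n (λ i → 1# - x i ^ 25)     ≈⟨ ∏-≋ n (λ i → frobenius² (x i)) ⟨
    A.∏ n (λ i → (1# - x i) ^ 25)   ≈⟨ ≈⇒≋ (A.∏-^ n (λ i → 1# - x i) 25) ⟩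
    A.∏ n (λ i → 1# - x i) ^ 25     ∎

  *-cancel-≋ : ∀ {c x p v} → p * v ≋ 1# → c * p ≋ p * x → c ≋ x
  *-cancel-≋ {c} {x} {p} {v} pv≋1 cp≋px = begin
    c             ≈⟨ trans (*-congˡ {c} pv≋1) (*-identityʳ c) ⟨
    c * (p * v)   ≈⟨ *-assoc c p v ⟨
    c * p * v     ≈⟨ *-congʳ {v} (trans cp≋px (*-comm p x)) ⟩
    x * p * v     ≈⟨ *-assoc x p v ⟩
    x * (p * v)   ≈⟨ trans (*-congˡ {x} pv≋1) (*-identityʳ x) ⟩
    x             ∎

constant : ℤ → Series
constant c n = c ℤ.* mono 0 n

constant-⊛ : ∀ c f → constant c ⊛ f ≗ λ n → c ℤ.* f n
constant-⊛ c f n = ≡.trans (⊛-scaleˡ c (mono 0) f n) (≡.cong (c ℤ.*_) (⊛-identityˡ f n))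

seriesScalars : ∀ N → Scalars (truncatedSeries N)
seriesScalars N = record
  { ⟦_⟧    = constant
  ; +-homo = λ a b n _ → ℤ.*-distribʳ-+ (mono 0 n) a b
  ; *-homo = λ a b n _ → ≡.trans (ℤ.*-assoc a b (mono 0 n)) (≡.sym (constant-⊛ a (constant b) n))
  ; -‿homo = λ a n _ → ≡.sym (ℤ.neg-distribˡ-* a (mono 0 n))
  ; 0-homo = λ _ _ → ≡.refl
  ; 1-homo = λ n _ → ℤ.*-identityˡ (mono 0 n)
  }

-- The Euler product and the Eisenstein series up to q^N.

module TruncatedSeries (N : ℕ) where

  open IntegerAlgebra (truncatedSeries N) (seriesScalars N) public
  open Derivation (truncatedSeries N) (seriesScalars N)
  open Solver

  θ-isDerivation : IsDerivation θ
  θ-isDerivation = record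
    { θ-cong = λ f≈g n n≤N → ≡.cong (+ n ℤ.*_) (f≈g n n≤N)
    ; θ-+    = λ f g n _ → ℤ.*-distribˡ-+ (+ n) (f n) (g n)
    ; θ-*    = λ f g n _ → θ-⊛ f g n
    ; θ-κ    = λ { c zero _ → ≡.refl ; c (suc n) _ → ≡.trans (≡.cong (+ suc n ℤ.*_) (ℤ.*-zeroʳ c))
      (ℤ.*-zeroʳ (+ suc n)) }
    }

  mono≈0 : ∀ {m} → N ℕ.< m → mono m ≈ 0#
  mono≈0 N<m n n≤N = mono-vanish n≤N N<m

  mono-^ : ∀ m k → mono m ^ k ≈ mono (k ℕ.* m)
  mono-^ m zero    = refl
  mono-^ m (suc k) = trans (*-congˡ {mono m} (mono-^ m k)) (λ n _ → mono-⊛ m (k ℕ.* m) n)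

  factor : ℕ → Series
  factor k = 1# - mono (suc k)

  euler : Series
  euler = ∏ N factor

  -- For M = N, this is q^(k+1) / (1 - q^(k+1)) up to q^N. Leaving out the constant term 1 makes it
  -- a row of the double sum in `lambert`.
  geometric : ℕ → ℕ → Series
  geometric k M n = ∑ M λ x → mono (suc k ℕ.* suc x) n

  factor-geometric : ∀ k M → factor k * geometric k M ≈ mono (suc k) - mono (suc k ℕ.* suc M)
  factor-geometric k zero    = begin
    factor k * 0#                        ≈⟨ zeroʳ (factor k) ⟩
    0#                                   ≈⟨ -‿inverseʳ (mono (suc k)) ⟨
    mono (suc k) - mono (suc k)
      ≡⟨ ≡.cong (λ m → mono (suc k) - mono m) (≡.sym (ℕ.*-identityʳ (suc k))) ⟩
    mono (suc k) - mono (suc k ℕ.* 1)    ∎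
  factor-geometric k (suc M) = begin
    factor k * (geometric k M + mono m)
      ≈⟨ distribˡ (factor k) (geometric k M) (mono m) ⟩
    factor k * geometric k M + factor k * mono m
      ≈⟨ +-cong (factor-geometric k M) (trans (distribʳ (mono m) 1# (- mono (suc k)))
           (+-cong (*-identityˡ (mono m)) (trans (sym (-‿distribˡ-* (mono (suc k)) (mono m)))
             (-‿cong (λ n _ → ≡.trans (mono-⊛ (suc k) m n)
               (≡.cong (λ j → mono j n) (≡.sym (ℕ.*-suc (suc k) (suc M))))))))) ⟩
    mono (suc k) - mono m + (mono m - mono (suc k ℕ.* suc (suc M)))
      ≈⟨ solve 3 (λ x y z → x :- y :+ (y :- z) := x :- z) refl (mono (suc k)) (mono m)
        (mono (suc k ℕ.* suc (suc M))) ⟩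
    mono (suc k) - mono (suc k ℕ.* suc (suc M))
      ∎
    where
    m = suc k ℕ.* suc M
    open import Algebra.Properties.Ring ring using (-‿distribˡ-*)

  factor-geometric-N : ∀ k → factor k * geometric k N ≈ mono (suc k)
  factor-geometric-N k = begin
    factor k * geometric k N                 ≈⟨ factor-geometric k N ⟩
    mono (suc k) - mono (suc k ℕ.* suc N)
      ≈⟨ +-congˡ {mono (suc k)} (-‿cong (mono≈0 (ℕ.m≤n*m (suc N) (suc k)))) ⟩
    mono (suc k) - 0#                        ≈⟨ solve 1 (λ x → x :- con 0ℤ := x) refl (mono (suc k)) ⟩
    mono (suc k)                             ∎

  factor-inverse : ∀ k → factor k * (1# + geometric k N) ≈ 1#
  factor-inverse k = begin
    factor k * (1# + geometric k N)            ≈⟨ distribˡ (factor k) 1# (geometric k N) ⟩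
    factor k * 1# + factor k * geometric k N
      ≈⟨ +-cong (*-identityʳ (factor k)) (factor-geometric-N k) ⟩
    1# - mono (suc k) + mono (suc k)
      ≈⟨ solve 2 (λ u x → u :- x :+ x := u) refl 1# (mono (suc k)) ⟩
    1#                                         ∎

  euler-inverse : euler * ∏ N (λ k → 1# + geometric k N) ≈ 1#
  euler-inverse = ∏-inverse N factor-inverse

  θ-mono : ∀ m → θ (mono m) ≈ κ (+ m) * mono m
  θ-mono m n _ = ≡.trans (≡.sym (mono-support m n (λ k → + k))) (≡.sym (constant-⊛ (+ m) (mono m) n))

  θ-factor : ∀ k → θ (factor k) ≈ - (κ (+ suc k) * geometric k N) * factor k
  θ-factor k = begin
    θ (factor k)
      ≈⟨ trans (θ-+ 1# (- mono (suc k))) (+-cong (θ-1 θ-isDerivation)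
        (θ-neg θ-isDerivation (mono (suc k)))) ⟩
    0# - θ (mono (suc k))
      ≈⟨ trans (+-identityˡ _) (-‿cong (trans (θ-mono (suc k))
        (*-congˡ {κ (+ suc k)} (sym (factor-geometric-N k))))) ⟩
    - (κ (+ suc k) * (factor k * geometric k N))
      ≈⟨ solve 3 (λ c f g → :- (c :* (f :* g)) := :- (c :* g) :* f) refl (κ (+ suc k)) (factor k)
        (geometric k N) ⟩
    - (κ (+ suc k) * geometric k N) * factor k
      ∎
    where
    open IsDerivation θ-isDerivation

  -- The factor 1 - q^m has logarithmic derivative -m q^m / (1 - q^m); summed over m, these are the
  -- rows of -S₁.
  θ-euler : θ euler ≈ - S₁ N * euler
  θ-euler = trans (θ-∏ θ-isDerivation θ-factor N) (*-congʳ {euler} (λ n _ → total N n))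
    where
    total : ∀ M n → ∑# θ-isDerivation M (λ k → - (κ (+ suc k) * geometric k N)) n
                  ≡ ℤ.- ∑ M (λ a → ∑ N λ x → + suc a ℤ.* mono (suc a ℕ.* suc x) n)
    total zero    n = ≡.refl
    total (suc M) n = ≡.trans
      (≡.cong₂ ℤ._+_ (total M n) (≡.cong ℤ.-_
        (≡.trans (constant-⊛ (+ suc M) (geometric M N) n) (≡.sym (∑-*ˡ N (+ suc M) _)))))
      (≡.sym (ℤ.neg-distrib-+ (∑ M _) _))

  ⊛-low : ∀ f g n → (∀ i → i ℕ.< n → g i ≡ 0ℤ) → (f ⊛ g) n ≡ f 0 ℤ.* g n
  ⊛-low f g zero    g≡0 = ≡.refl
  ⊛-low f g (suc n) g≡0 = +-dropʳ (f 0 ℤ.* g (suc n)) (≡.trans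
    (⊛-low (tail f) g n (λ i i<n → g≡0 i (ℕ.m<n⇒m<1+n i<n)))
    (≡.trans (≡.cong (f 1 ℤ.*_) (g≡0 n ℕ.≤-refl)) (ℤ.*-zeroʳ (f 1))))

  -- If the coefficients of g below n vanish, comparing those of q^n gives n g(n) = f(0) g(n) =
  -- g(n), hence g(n) = 0 for n ≥ 2. For n = 1 the comparison is vacuous, whence the condition on
  -- g(1).
  θ-unique : ∀ f g → f 0 ≡ 1ℤ → θ g ≈ f * g → g 0 ≡ 0ℤ → g 1 ≡ 0ℤ → g ≈ 0#
  θ-unique f g f₀≡1 θg≈fg g₀≡0 g₁≡0 = <-rec _ step
    where
    step : ∀ n → (∀ {i} → i ℕ.< n → i ℕ.≤ N → g i ≡ 0ℤ) → n ℕ.≤ N → g n ≡ 0ℤ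
    step zero          rec _ = g₀≡0
    step (suc zero)    rec _ = g₁≡0
    step (suc (suc n)) rec n≤N = ℤ.*-cancelˡ-≡ (+ suc n) _ _ (≡R.begin
      + suc n ℤ.* g (suc (suc n))                            ≡R.≡⟨ split (+ suc n) (g (suc (suc n))) ⟩
      + suc (suc n) ℤ.* g (suc (suc n)) ℤ.- g (suc (suc n))
        ≡R.≡⟨ ≡.cong (ℤ._- g (suc (suc n))) (≡.trans (θg≈fg _ n≤N)
        (⊛-low f g _ (λ i i<n → rec i<n (ℕ.≤-trans (ℕ.<⇒≤ i<n) n≤N)))) ⟩
      f 0 ℤ.* g (suc (suc n)) ℤ.- g (suc (suc n))
        ≡R.≡⟨ ≡.cong (λ c → c ℤ.* g (suc (suc n)) ℤ.- g (suc (suc n))) f₀≡1 ⟩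
      1ℤ ℤ.* g (suc (suc n)) ℤ.- g (suc (suc n))             ≡R.≡⟨ cancel (+ suc n) (g (suc (suc n))) ⟩
      + suc n ℤ.* 0ℤ                                         ≡R.∎)
      where
      module ≡R = ≡.≡-Reasoning
      split : ∀ k x → k ℤ.* x ≡ (1ℤ ℤ.+ k) ℤ.* x ℤ.- x
      split = solve-∀
      cancel : ∀ k x → 1ℤ ℤ.* x ℤ.- x ≡ k ℤ.* 0ℤ
      cancel = solve-∀

  E-0 : ∀ c w → E θ-isDerivation c (lambert N w) 0 ≡ 1ℤ
  E-0 c w = ≡.cong (ℤ._+_ 1ℤ) (≡.trans (constant-⊛ c (lambert N w) 0)
    (≡.trans (≡.cong (c ℤ.*_) lambert-0) (ℤ.*-zeroʳ c)))
    where
    lambert-0 : lambert N w 0 ≡ 0ℤ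
    lambert-0 = ∑-vanish N λ a → ∑-vanish N λ x → ℤ.*-zeroʳ (w (+ suc a))

  -- Only a = x = 1 contributes to q, and N ≥ 1 keeps this term in range.
  E-1 : 1 ℕ.≤ N → ∀ c w → E θ-isDerivation c (lambert N w) 1 ≡ c ℤ.* w 1ℤ
  E-1 (s≤s {n = M} _) c w = ≡.trans (ℤ.+-identityˡ _)
    (≡.trans (constant-⊛ c (lambert N w) 1) (≡.cong (c ℤ.*_) lambert-1))
    where
    off : ∀ a {m} → 1 ℕ.< m → w (+ suc a) ℤ.* mono m 1 ≡ 0ℤ
    off a 1<m = ≡.trans (≡.cong (w (+ suc a) ℤ.*_) (mono-vanish ℕ.≤-refl 1<m)) (ℤ.*-zeroʳ (w (+ suc a)))
    lambert-1 : lambert N w 1 ≡ w 1ℤ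
    lambert-1 = ≡.trans (∑-head M _) (≡.trans
      (+-dropʳ _ (∑-vanish M λ a → ∑-vanish N λ x → off (suc a) {suc (suc a) ℕ.* suc x}
        (s≤s (ℕ.≤-trans (s≤s z≤n) (ℕ.m≤n+m (suc a ℕ.* suc x) x)))))
      (≡.trans (∑-head M _) (≡.trans
        (+-dropʳ _ (∑-vanish M λ x → off 0 {1 ℕ.* suc (suc x)} (s≤s (s≤s z≤n))))
        (ℤ.*-identityʳ (w 1ℤ)))))

  euler-0 : ∀ n → ∏ n factor 0 ≡ 1ℤ
  euler-0 zero    = ≡.refl
  euler-0 (suc n) = ≡.cong (ℤ._* 1ℤ) (euler-0 n)

  ^-0 : ∀ {f} → f 0 ≡ 1ℤ → ∀ n → (f ^ n) 0 ≡ 1ℤ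
  ^-0 f₀≡1 zero    = ≡.refl
  ^-0 f₀≡1 (suc n) = ≡.cong₂ ℤ._*_ f₀≡1 (^-0 f₀≡1 n)

  weight₄ : κ (+ 240) * (S₁ N * S₃ N) + κ (+ 30) * θ (S₃ N) + S₁ N ≈ κ (+ 21) * S₅ N + κ (+ 10) * S₃ N
  weight₄ n n≤N = ≡.trans
    (≡.cong (ℤ._+ S₁ N n) (≡.cong₂ ℤ._+_ (constant-⊛ (+ 240) (S₁ N ⊛ S₃ N) n)
      (constant-⊛ (+ 30) (θ (S₃ N)) n)))
    (≡.trans (Weight₄.identity N n≤N)
      (≡.sym (≡.cong₂ ℤ._+_ (constant-⊛ (+ 21) (S₅ N) n) (constant-⊛ (+ 10) (S₃ N) n))))

  weight₆ : κ (+ 504) * (S₁ N * S₅ N) + κ (ℤ.- + 2400) * (S₃ N * S₃ N) + κ (+ 42) * θ (S₅ N)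
          ≈ κ (+ 21) * S₅ N + κ (+ 20) * S₃ N + S₁ N
  weight₆ n n≤N = ≡.trans
    (≡.cong₂ ℤ._+_ (≡.cong₂ ℤ._+_ (constant-⊛ (+ 504) (S₁ N ⊛ S₅ N) n)
      (constant-⊛ (ℤ.- + 2400) (S₃ N ⊛ S₃ N) n))
      (constant-⊛ (+ 42) (θ (S₅ N)) n))
    (≡.trans (Weight₆.identity N n≤N)
      (≡.cong (ℤ._+ S₁ N n) (≡.sym (≡.cong₂ ℤ._+_ (constant-⊛ (+ 21) (S₅ N) n)
        (constant-⊛ (+ 20) (S₃ N) n)))))

  ηpower : Series
  ηpower = mono 1 * euler ^ 24

  module _ (1≤N : 1 ℕ.≤ N) where

    open Eisenstein θ-isDerivation (S₁ N) (S₃ N) (S₅ N) weight₄ weight₆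

    -- The logarithmic derivatives 1 of q and -24 S₁ of the 24th power add up to E₂.
    θ-ηpower : θ ηpower ≈ E₂ * ηpower
    θ-ηpower = begin
      θ ηpower
        ≈⟨ θ-* (mono 1) (euler ^ 24) ⟩
      θ (mono 1) * euler ^ 24 + mono 1 * θ (euler ^ 24)
        ≈⟨ +-cong (*-congʳ {euler ^ 24} (θ-mono 1)) (*-congˡ {mono 1} (θ-^ θ-isDerivation θ-euler 24)) ⟩
      κ 1ℤ * mono 1 * euler ^ 24 + mono 1 * (κ (+ 24) * - S₁ N * euler ^ 24)
        ≈⟨ solve 3 (λ q s p → con 1ℤ :* q :* p :+ q :* (con (+ 24) :* :- s :* p)
             := (con 1ℤ :+ con (ℤ.- + 24) :* s) :* (q :* p)) refl (mono 1) (S₁ N) (euler ^ 24) ⟩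
      E₂ * ηpower
        ∎
      where
      open IsDerivation θ-isDerivation

    -- The difference z of the two sides satisfies θ z = E₂ z, which leaves its coefficients at 0
    -- and 1 to be checked.
    discriminant-ηpower : κ (+ 1728) * ηpower ≈ discriminant
    discriminant-ηpower = x∙y⁻¹≈ε⇒x≈y _ _ (θ-unique E₂ z (E-0 (ℤ.- + 24) (λ a → a)) θz z-0 z-1)
      where
      open import Algebra.Properties.Group +-group using (x∙y⁻¹≈ε⇒x≈y)
      open IsDerivation θ-isDerivation
      coefficient-0 : ∀ {a c} → a ≡ 1ℤ → c ≡ 1ℤ → 0ℤ ℤ.+ ℤ.- (a ℤ.* (a ℤ.* a) ℤ.+ ℤ.- (c ℤ.* c)) ≡ 0ℤ
      coefficient-0 ≡.refl ≡.refl = ≡.refl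
      -- The left-hand side is the coefficient of q as `⊛` unfolds it; it vanishes because 1728 = 3
      -- * 240 + 2 * 504.
      coefficient-1 : ∀ {p a b c d} → p ≡ 1ℤ → a ≡ 1ℤ → b ≡ + 240 → c ≡ 1ℤ → d ≡ ℤ.- + 504 →
        + 1728 ℤ.* (0ℤ ℤ.+ 1ℤ ℤ.* p)
          ℤ.- (a ℤ.* (a ℤ.* b ℤ.+ b ℤ.* a) ℤ.+ b ℤ.* (a ℤ.* a) ℤ.+ ℤ.- (c ℤ.* d ℤ.+ d ℤ.* c)) ≡ 0ℤ
      coefficient-1 ≡.refl ≡.refl ≡.refl ≡.refl ≡.refl = ≡.refl
      z : Series
      z = κ (+ 1728) * ηpower - discriminant
      θz : θ z ≈ E₂ * z
      θz = begin
        θ z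
          ≈⟨ trans (θ-+ (κ (+ 1728) * ηpower) (- discriminant))
               (+-cong (θ-scale θ-isDerivation (+ 1728) ηpower) (θ-neg θ-isDerivation discriminant)) ⟩
        κ (+ 1728) * θ ηpower - θ discriminant
          ≈⟨ +-cong (*-congˡ {κ (+ 1728)} θ-ηpower) (-‿cong θ-discriminant) ⟩
        κ (+ 1728) * (E₂ * ηpower) - E₂ * discriminant
          ≈⟨ solve 3 (λ e y d → con (+ 1728) :* (e :* y) :- e :* d := e :* (con (+ 1728) :* y :- d))
            refl E₂ ηpower discriminant ⟩
        E₂ * z
          ∎
      z-0 : z 0 ≡ 0ℤ
      z-0 = coefficient-0 (E-0 (+ 240) ⟦ cube ⟧₁) (E-0 (ℤ.- + 504) ⟦ fifth ⟧₁)
      z-1 : z 1 ≡ 0ℤ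
      z-1 = ≡.trans (≡.cong (ℤ._- discriminant 1) (constant-⊛ (+ 1728) ηpower 1))
        (coefficient-1 (^-0 {euler} (euler-0 N) 24) (E-0 (+ 240) ⟦ cube ⟧₁) (E-1 1≤N (+ 240) ⟦ cube ⟧₁)
          (E-0 (ℤ.- + 504) ⟦ fifth ⟧₁) (E-1 1≤N (ℤ.- + 504) ⟦ fifth ⟧₁))

  -- The integer (a^5 - a) / 5, built up from its differences a^4 + 2 a^3 + 2 a^2 + a.
  fermatQuotient : ℕ → ℤ
  fermatQuotient zero    = 0ℤ
  fermatQuotient (suc a) =
    fermatQuotient a ℤ.+ (+ a ℤ.* (+ a ℤ.* + a ℤ.* + a ℤ.+ + 2 ℤ.* (+ a ℤ.* + a) ℤ.+ + 2 ℤ.* + a ℤ.+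
      1ℤ))

  fifth-power : ∀ a → ⟦ fifth ⟧₁ (+ a) ≡ + a ℤ.+ + 5 ℤ.* fermatQuotient a
  fifth-power zero    = ≡.refl
  fifth-power (suc a) = ≡.trans (binomial (+ a))
    (≡.trans (≡.cong (ℤ._+ _) (fifth-power a)) (collect (+ a) (fermatQuotient a) _))
    where
    binomial : ∀ a → (1ℤ ℤ.+ a) ℤ.* (1ℤ ℤ.+ a) ℤ.* (1ℤ ℤ.+ a) ℤ.* (1ℤ ℤ.+ a) ℤ.* (1ℤ ℤ.+ a)
      ≡ a ℤ.* a ℤ.* a ℤ.* a ℤ.* a ℤ.+ (1ℤ ℤ.+ + 5 ℤ.*
        (a ℤ.* (a ℤ.* a ℤ.* a ℤ.+ + 2 ℤ.* (a ℤ.* a) ℤ.+ + 2 ℤ.* a ℤ.+ 1ℤ)))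
    binomial = solve-∀
    collect : ∀ a q r → a ℤ.+ + 5 ℤ.* q ℤ.+ (1ℤ ℤ.+ + 5 ℤ.* r) ≡ 1ℤ ℤ.+ a ℤ.+ + 5 ℤ.* (q ℤ.+ r)
    collect = solve-∀

  open ModuloFive (truncatedSeries N) (seriesScalars N)
    using (_≋_; ≈⇒≋; *-cancel-≋; frobenius-∏; discriminant≋)

  S₅≋S₁ : S₅ N ≋ S₁ N
  S₅≋S₁ = lambert N quotient , λ n _ → ≡.trans
    (∑∑-cong N λ a x → ≡.cong (ℤ._* mono (suc a ℕ.* suc x) n) (fifth-power (suc a)))
    (≡.trans (lambert-+ N (λ a → a) (λ a → + 5 ℤ.* quotient a) n) (≡.cong (ℤ._+_ (S₁ N n))
      (≡.trans (lambert-*ˡ N (+ 5) quotient n) (≡.sym (constant-⊛ (+ 5) (lambert N quotient) n)))))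
    where
    -- `lambert` evaluates weights at positive integers only, so the absolute value serves as an
    -- arbitrary extension.
    quotient : ℤ → ℤ
    quotient a = fermatQuotient ℤ.∣ a ∣

  mono-1-suc : ∀ f n → (mono 1 ⊛ f) (suc n) ≡ f n
  mono-1-suc f n = ≡.trans (ℤ.+-identityˡ _) (⊛-identityˡ f n)

  -- Modulo 5 the right-hand product is the 25th power of `euler`; cancelling the invertible `euler`
  -- leaves c ≡ euler^24. Multiplication by q shifts the index n to n + 1, which must not exceed N.
  regular-congruence : ∀ c → c * euler ≈ ∏ N (λ j → 1# - mono (25 ℕ.* suc j)) →
    ∀ n → n ℕ.< N → + 5 ℤ.∣ c n ℤ.- + suc n ℤ.* S₁ N (suc n)
  regular-congruence c c*euler≈ n n<N = ℤ.divides (proj₁ shifted (suc n))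
    (difference (c n) (θ (S₁ N) (suc n)) (proj₁ shifted (suc n))
    (≡.trans (≡.sym (mono-1-suc c n)) (≡.trans (proj₂ shifted (suc n) n<N)
      (≡.cong (ℤ._+_ (θ (S₁ N) (suc n))) (constant-⊛ (+ 5) (proj₁ shifted) (suc n))))))
    where
    module Q = CommutativeRing (Modulo.quotient (truncatedSeries N) (seriesScalars N) (+ 5))
    1≤N : 1 ℕ.≤ N
    1≤N = ℕ.≤-trans (s≤s z≤n) n<N
    difference : ∀ a b h → a ≡ b ℤ.+ + 5 ℤ.* h → a ℤ.- b ≡ h ℤ.* + 5
    difference a b h ≡.refl = lemma b h
      where
      lemma : ∀ b h → b ℤ.+ + 5 ℤ.* h ℤ.- b ≡ h ℤ.* + 5
      lemma = solve-∀
    ≋-trans : ∀ x y z → x ≋ y → y ≋ z → x ≋ z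
    ≋-trans x y z = Q.trans {x} {y} {z}
    frobenius : ∏ N (λ j → 1# - mono (25 ℕ.* suc j)) ≋ euler * euler ^ 24
    frobenius = ≋-trans _ (∏ N (λ j → 1# - mono (suc j) ^ 25)) (euler * euler ^ 24)
      (≈⇒≋ (∏-cong N (λ j → +-congˡ {1#} (-‿cong (sym (mono-^ (suc j) 25))))))
      (frobenius-∏ N (λ j → mono (suc j)))
    c≋ : c ≋ euler ^ 24
    c≋ = *-cancel-≋ {c} {euler ^ 24} {euler} (≈⇒≋ euler-inverse)
      (≋-trans (c * euler) (∏ N (λ j → 1# - mono (25 ℕ.* suc j))) (euler * euler ^ 24)
        (≈⇒≋ c*euler≈) frobenius)
    shifted : mono 1 * c ≋ θ (S₁ N)
    shifted = ≋-trans (mono 1 * c) ηpower (θ (S₁ N)) (Q.*-congˡ {mono 1} c≋)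
      (discriminant≋ θ-isDerivation (S₁ N) (S₃ N) (S₅ N) S₅≋S₁ weight₄ weight₆
        (discriminant-ηpower 1≤N))

open ≡ using (refl)

-- Counting regular partitions with bounded parts.

unique-length : ∀ {a} {A : Set a} {xs ys : List A} → Unique xs → Unique ys →
  (∀ {x} → x ∈ xs → x ∈ ys) → (∀ {x} → x ∈ ys → x ∈ xs) → length xs ≡ length ys
unique-length xs! ys! xs⊆ys ys⊆xs = ↭-length (∼bag⇒↭ (unique∧set⇒bag xs! ys! (mk⇔ xs⊆ys ys⊆xs)))

module RegularPartitions (ℓ : ℕ) where

  -- Bounding the parts by m allows an induction in which each step accounts for one factor of the
  -- generating function.
  bounded : ℕ → ℕ → List (List ℕ)
  bounded m n = filter (all? (ℕ._≤? m)) (regularPartitions ℓ n)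

  bounded-unique : ∀ m n → Unique (bounded m n)
  bounded-unique m n = Unique.filter⁺ (all? (ℕ._≤? m)) (regularPartitions-unique ℓ n)

  ∈-bounded⁺ : ∀ {m n ps} → IsRegularPartition ℓ n ps → All (ℕ._≤ m) ps → ps ∈ bounded m n
  ∈-bounded⁺ {m} reg ps≤m = ∈-filter⁺ (all? (ℕ._≤? m)) (Equivalence.from ∈-regularPartitions reg) ps≤m

  ∈-bounded⁻ : ∀ m n {ps} → ps ∈ bounded m n → IsRegularPartition ℓ n ps × All (ℕ._≤ m) ps
  ∈-bounded⁻ m n ps∈ with ∈-filter⁻ (all? (ℕ._≤? m)) {xs = regularPartitions ℓ n} ps∈
  ... | ps∈′ , ps≤m = Equivalence.to ∈-regularPartitions ps∈′ , ps≤m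

  count : ℕ → Series
  count m n = + length (bounded m n)

  bounded-all : ∀ {m n} → n ℕ.≤ m → bounded m n ≡ regularPartitions ℓ n
  bounded-all {m} n≤m = List.filter-all (all? (ℕ._≤? m)) (All.tabulate λ {ps} ps∈ →
    All.map (λ p≤ → ℕ.≤-trans p≤ n≤m)
      (≡.subst (λ k → All (ℕ._≤ k) ps) (IsPartition.total
        (proj₁ (Equivalence.to ∈-regularPartitions ps∈))) (parts≤sum ps)))

  count-0 : count 0 ≗ mono 0
  count-0 zero    = ≡.cong +_ (unique-length (bounded-unique 0 0) ([] ∷ [])
    (λ ps∈ → here (empty (∈-bounded⁻ 0 0 ps∈)))
    (λ { (here refl) → ∈-bounded⁺ {0} (isPartition [] [] refl , []) [] }))
    where
    empty : ∀ {ps} → IsRegularPartition ℓ 0 ps × All (ℕ._≤ 0) ps → ps ≡ []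
    empty {[]} _ = refl
    empty {p ∷ ps} ((isPartition _ (p>0 ∷ _) _ , _) , p≤0 ∷ _) = contradiction p≤0 (ℕ.<⇒≱ p>0)
  count-0 (suc n) = ≡.cong +_ (unique-length (bounded-unique 0 (suc n)) []
    (λ ps∈ → ⊥-elim (nonempty (∈-bounded⁻ 0 (suc n) ps∈))) (λ ()))
    where
    nonempty : ∀ {ps} → IsRegularPartition ℓ (suc n) ps × All (ℕ._≤ 0) ps → ⊥
    nonempty {[]} ((isPartition _ _ () , _) , _)
    nonempty {p ∷ ps} ((isPartition _ (p>0 ∷ _) _ , _) , p≤0 ∷ _) = ℕ.<⇒≱ p>0 p≤0

  head≤ : ∀ {m p ps} → Linked ℕ._≥_ (p ∷ ps) → p ℕ.≤ m → All (ℕ._≤ m) (p ∷ ps)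
  head≤ dec p≤m = Linked.Linked⇒All (λ a≥b b≥c → ℕ.≤-trans b≥c a≥b) p≤m dec

  tail-linked : ∀ {p ps} → Linked ℕ._≥_ (p ∷ ps) → Linked ℕ._≥_ ps
  tail-linked [-]       = []
  tail-linked (_ ∷ dec) = dec

  cons-linked : ∀ {p ps} → All (ℕ._≤ p) ps → Linked ℕ._≥_ ps → Linked ℕ._≥_ (p ∷ ps)
  cons-linked []        []  = [-]
  cons-linked (q≤p ∷ _) dec = q≤p ∷ dec

  weaken : ∀ m n {ps} → ps ∈ bounded m n → ps ∈ bounded (suc m) n
  weaken m n ps∈ with ∈-bounded⁻ m n ps∈
  ... | reg , ps≤m = ∈-bounded⁺ reg (All.map ℕ.m≤n⇒m≤1+n ps≤m)

  -- The parts decrease, so if m + 1 occurs at all, it is the head and can be removed.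
  split : ∀ m n {ps} → ps ∈ bounded (suc m) n →
    ps ∈ bounded m n
      ⊎ ∃ λ qs → ps ≡ suc m ∷ qs × ℓ ℕ.∤ suc m × ∃ λ k → n ≡ suc m ℕ.+ k × qs ∈ bounded (suc m) k
  split m n ps∈ with ∈-bounded⁻ (suc m) n ps∈
  split m n {[]} ps∈ | reg , _ = inj₁ (∈-bounded⁺ reg [])
  split m n {p ∷ ps} ps∈ | reg@(isPartition dec (_ ∷ pos) tot , ℓ∤p ∷ ℓ∤ps) , p≤ ∷ ps≤ with
    ℕ.m≤n⇒m<n∨m≡n p≤
  ... | inj₁ (s≤s p≤m) = inj₁ (∈-bounded⁺ reg (head≤ dec p≤m))
  ... | inj₂ refl = inj₂ (ps , refl , ℓ∤p , sum ps , ≡.sym tot ,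
          ∈-bounded⁺ (isPartition (tail-linked dec) pos refl , ℓ∤ps) ps≤)

  count-∣ : ∀ {m} → ℓ ℕ.∣ suc m → count (suc m) ≗ count m
  count-∣ {m} ℓ∣ n = ≡.cong +_ (unique-length (bounded-unique (suc m) n) (bounded-unique m n)
    strengthen (weaken m n))
    where
    strengthen : ∀ {ps} → ps ∈ bounded (suc m) n → ps ∈ bounded m n
    strengthen ps∈ with split m n ps∈
    ... | inj₁ ps∈m = ps∈m
    ... | inj₂ (_ , _ , ℓ∤ , _) = contradiction ℓ∣ ℓ∤

  count-< : ∀ {m n} → n ℕ.< suc m → count (suc m) n ≡ count m n
  count-< {m} {n} n<m = ≡.cong +_ (unique-length (bounded-unique (suc m) n) (bounded-unique m n)
    strengthen (weaken m n))
    where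
    strengthen : ∀ {ps} → ps ∈ bounded (suc m) n → ps ∈ bounded m n
    strengthen ps∈ with split m n ps∈
    ... | inj₁ ps∈m = ps∈m
    ... | inj₂ (_ , _ , _ , k , refl , _) = contradiction n<m (ℕ.≤⇒≯ (ℕ.m≤m+n (suc m) k))

  -- After one part m + 1 is removed, the others may still equal m + 1; so the second count keeps
  -- the bound m + 1, as in F = G + q^(m+1) F.
  count-∤ : ∀ {m} → ℓ ℕ.∤ suc m → ∀ k →
    count (suc m) (suc m ℕ.+ k) ≡ count m (suc m ℕ.+ k) ℤ.+ count (suc m) k
  count-∤ {m} ℓ∤ k = ≡.trans (≡.cong +_ (≡.trans
    (unique-length (bounded-unique (suc m) n) union-unique to from)
    (≡.trans (List.length-++ (bounded m n)) (≡.cong (length (bounded m n) ℕ.+_)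
      (List.length-map (suc m ∷_) (bounded (suc m) k))))))
    (ℤ.pos-+ (length (bounded m n)) _)
    where
    n = suc m ℕ.+ k
    union-unique : Unique (bounded m n ++ map (suc m ∷_) (bounded (suc m) k))
    union-unique = Unique.++⁺ (bounded-unique m n)
      (Unique.map⁺ List.∷-injectiveʳ (bounded-unique (suc m) k)) disjoint
      where
      disjoint : ∀ {ps} → ps ∈ bounded m n × ps ∈ map (suc m ∷_) (bounded (suc m) k) → ⊥
      disjoint (ps∈ , ps∈′) with ∈-map⁻ (suc m ∷_) ps∈′
      ... | _ , _ , refl with ∈-bounded⁻ m n ps∈
      ... | _ , p≤m ∷ _ = ℕ.<-irrefl refl p≤m
    to : ∀ {ps} → ps ∈ bounded (suc m) n → ps ∈ bounded m n ++ map (suc m ∷_) (bounded (suc m) k)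
    to ps∈ with split m n ps∈
    ... | inj₁ ps∈m = ∈-++⁺ˡ ps∈m
    ... | inj₂ (qs , refl , _ , k′ , n≡ , qs∈) with ℕ.+-cancelˡ-≡ (suc m) k k′ n≡
    ... | refl = ∈-++⁺ʳ (bounded m n) (∈-map⁺ (suc m ∷_) qs∈)
    from : ∀ {ps} → ps ∈ bounded m n ++ map (suc m ∷_) (bounded (suc m) k) → ps ∈ bounded (suc m) n
    from ps∈ with ∈-++⁻ (bounded m n) ps∈
    ... | inj₁ ps∈m = weaken m n ps∈m
    ... | inj₂ ps∈′ with ∈-map⁻ (suc m ∷_) ps∈′
    ... | qs , qs∈ , refl with ∈-bounded⁻ (suc m) k qs∈
    ... | (isPartition dec pos refl , ℓ∤qs) , qs≤ =
      ∈-bounded⁺ (isPartition (cons-linked qs≤ dec) (s≤s z≤n ∷ pos) refl , ℓ∤ ∷ ℓ∤qs) (ℕ.≤-refl ∷ qs≤)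

-- The generating function of 25-regular partitions.

mono-⊛-< : ∀ {m n} f → n ℕ.< m → (mono m ⊛ f) n ≡ 0ℤ
mono-⊛-< {suc m} {zero}  f _         = refl
mono-⊛-< {suc m} {suc n} f (s≤s n<m) = ≡.trans (ℤ.+-identityˡ _) (mono-⊛-< f n<m)

mono-⊛-+ : ∀ m f k → (mono m ⊛ f) (m ℕ.+ k) ≡ f k
mono-⊛-+ zero    f k = ⊛-identityˡ f k
mono-⊛-+ (suc m) f k = ≡.trans (ℤ.+-identityˡ _) (mono-⊛-+ m f k)

module PartitionSeries (N : ℕ) where

  open TruncatedSeries N renaming (refl to ≈-refl)
  open Solver
  open RegularPartitions 25

  count-recursion : ∀ {m} → 25 ℕ.∤ suc m → count (suc m) ≗ λ n → count m n ℤ.+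
    (mono (suc m) ⊛ count (suc m)) n
  count-recursion {m} ∤ n with n ℕ.<? suc m
  ... | yes n<m = ≡.trans (count-< n<m) (≡.sym (+-dropʳ (count m n) (mono-⊛-< (count (suc m)) n<m)))
  ... | no n≮m with ℕ.m≤n⇒∃[o]m+o≡n (ℕ.≮⇒≥ n≮m)
  ... | k , refl = ≡.trans (count-∤ ∤ k) (≡.cong (ℤ._+_ (count m n))
    (≡.sym (mono-⊛-+ (suc m) (count (suc m)) k)))

  -- The numerator of the generating function, padded with 1 at the other indices so that it grows
  -- in step with the denominator in the induction on m.
  multipleFactor : ℕ → Series
  multipleFactor k with 25 ℕ.∣? suc k
  ... | yes _ = factor k
  ... | no  _ = 1#

  count-factor : ∀ m → count (suc m) * factor m ≈ count m * multipleFactor m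
  count-factor m with 25 ℕ.∣? suc m
  ... | yes 25∣ = *-congʳ {factor m} (λ n _ → count-∣ 25∣ n)
  ... | no  25∤ = begin
    count (suc m) * factor m
      ≈⟨ solve 3 (λ c u q → c :* (u :- q) := c :* u :- q :* c) ≈-refl (count (suc m)) 1#
        (mono (suc m)) ⟩
    count (suc m) * 1# - mono (suc m) * count (suc m)
      ≈⟨ +-congʳ (trans (*-identityʳ (count (suc m))) (λ n _ → count-recursion 25∤ n)) ⟩
    count m + mono (suc m) * count (suc m) - mono (suc m) * count (suc m)
      ≈⟨ solve 2 (λ x y → x :+ y :- y := x) ≈-refl (count m) (mono (suc m) * count (suc m)) ⟩
    count m
      ≈⟨ *-identityʳ (count m) ⟨
    count m * 1#
      ∎

  count-∏ : ∀ m → count m * ∏ m factor ≈ ∏ m multipleFactor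
  count-∏ zero    = trans (*-identityʳ (count 0)) (λ n _ → count-0 n)
  count-∏ (suc m) = begin
    count (suc m) * (∏ m factor * factor m)
      ≈⟨ solve 3 (λ c p f → c :* (p :* f) := c :* f :* p) ≈-refl (count (suc m)) (∏ m factor)
        (factor m) ⟩
    count (suc m) * factor m * ∏ m factor
      ≈⟨ *-congʳ {∏ m factor} (count-factor m) ⟩
    count m * multipleFactor m * ∏ m factor
      ≈⟨ solve 3 (λ c p f → c :* f :* p := c :* p :* f) ≈-refl (count m) (∏ m factor)
        (multipleFactor m) ⟩
    count m * ∏ m factor * multipleFactor m
      ≈⟨ *-congʳ {multipleFactor m} (count-∏ m) ⟩
    ∏ m multipleFactor * multipleFactor m
      ∎

  multipleFactor-large : ∀ k → N ℕ.≤ k → multipleFactor k ≈ 1#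
  multipleFactor-large k N≤k with 25 ℕ.∣? suc k
  ... | yes _ = trans (+-congˡ {1#} (-‿cong (mono≈0 (s≤s N≤k))))
    (λ n _ → ≡.trans (ℤ.+-identityʳ _) refl)
  ... | no  _ = ≈-refl

  -- In a block of 25 consecutive indices, only the last one, k = 24 + 25 K, has k + 1 divisible by
  -- 25.
  multipleFactor-∏ : ∀ K → ∏ (K ℕ.* 25) multipleFactor ≈ ∏ K (λ j → 1# - mono (25 ℕ.* suc j))
  multipleFactor-∏ zero    = ≈-refl
  multipleFactor-∏ (suc K) = *-cong
    (trans (short 24 ℕ.≤-refl) (multipleFactor-∏ K))
    (multiple (24 ℕ.+ K ℕ.* 25) (ℕ.*-comm (suc K) 25) (ℕ.m∣m*n (suc K)))
    where
    short : ∀ r → r ℕ.< 25 → ∏ (r ℕ.+ K ℕ.* 25) multipleFactor ≈ ∏ (K ℕ.* 25) multipleFactor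
    short zero    _    = ≈-refl
    short (suc r) r<25 with 25 ℕ.∣? suc (r ℕ.+ K ℕ.* 25)
    ... | yes 25∣ = contradiction
      (ℕ.∣m+n∣m⇒∣n (≡.subst (25 ℕ.∣_) (ℕ.+-comm (suc r) (K ℕ.* 25)) 25∣) (ℕ.n∣m*n K)) (ℕ.>⇒∤ r<25)
    ... | no  _   = trans (*-identityʳ _) (short r (ℕ.<⇒≤ r<25))
    multiple : ∀ k {m} → suc k ≡ m → 25 ℕ.∣ m → multipleFactor k ≈ 1# - mono m
    multiple k refl 25∣m with 25 ℕ.∣? suc k
    ... | yes _   = ≈-refl
    ... | no  25∤ = contradiction 25∣m 25∤

  count-euler : count N * euler ≈ ∏ N (λ j → 1# - mono (25 ℕ.* suc j))
  count-euler = begin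
    count N * euler                              ≈⟨ count-∏ N ⟩
    -- Factors of index N or more are 1 up to q^N, so the range may be extended to 25 N, which
    -- consists of N whole blocks.
    ∏ N multipleFactor                           ≈⟨ ∏-drop N (N ℕ.* 24) multipleFactor-large ⟨
    ∏ (N ℕ.+ N ℕ.* 24) multipleFactor
      ≡⟨ ≡.cong (λ K → ∏ K multipleFactor) (≡.sym (ℕ.*-suc N 24)) ⟩
    ∏ (N ℕ.* 25) multipleFactor                  ≈⟨ multipleFactor-∏ N ⟩
    ∏ N (λ j → 1# - mono (25 ℕ.* suc j))         ∎

-- The shift by q requires precision n + 1. Parts of a partition of n are at most n, so the bound n
-- + 1 on them excludes nothing.
b-congruence : ∀ n → + 5 ℤ.∣ + b 25 n ℤ.- + suc n ℤ.* S₁ (suc n) (suc n)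
b-congruence n = ≡.subst (λ c → + 5 ℤ.∣ c ℤ.- + suc n ℤ.* S₁ (suc n) (suc n))
  (≡.cong (λ ps → + length ps) (bounded-all (ℕ.n≤1+n n)))
  (regular-congruence (count (suc n)) count-euler n ℕ.≤-refl)
  where
  open TruncatedSeries (suc n) using (regular-congruence)
  open PartitionSeries (suc n) using (count-euler)
  open RegularPartitions 25 using (count; bounded-all)

open import Data.Nat.Base using (_+_; _*_; _∸_; _^_; _≥_)

-- Divisor sums and their recurrence at a prime.

∑-single : ∀ n {q f} → q ℕ.< n → (∀ i → i ≢ q → f i ≡ 0ℤ) → ∑ n f ≡ f q
∑-single (suc n) {q} {f} q<1+n f≡0 with ℕ.m≤n⇒m<n∨m≡n q<1+n
... | inj₁ (s≤s q<n) = ≡.trans (+-dropʳ (∑ n f) (f≡0 n (ℕ.>⇒≢ q<n))) (∑-single n q<n f≡0)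
... | inj₂ refl      = ≡.trans
  (≡.cong (ℤ._+ f n) (≡.trans (∑-cong-< n (λ {i} i<n → f≡0 i (ℕ.<⇒≢ i<n))) (∑-zero n)))
    (ℤ.+-identityˡ (f n))

∑-blocks : ∀ p n f → ∑ (n * p) f ≡ ∑ n (λ k → ∑ p (λ r → f (r + k * p)))
∑-blocks p zero    f = refl
∑-blocks p (suc n) f = ≡.trans (block p) (≡.cong (ℤ._+ ∑ p (λ r → f (r + n * p))) (∑-blocks p n f))
  where
  block : ∀ q → ∑ (q + n * p) f ≡ ∑ (n * p) f ℤ.+ ∑ q (λ r → f (r + n * p))
  block zero    = ≡.sym (ℤ.+-identityʳ _)
  block (suc q) = ≡.trans (≡.cong (ℤ._+ f (q + n * p)) (block q)) (ℤ.+-assoc (∑ (n * p) f) _ _)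

[_∣_] : ℕ → ℕ → ℤ
[ d ∣ n ] with d ℕ.∣? n
... | yes _ = 1ℤ
... | no  _ = 0ℤ

[∣]-⇔ : ∀ {c d m n} → (c ∣ m → d ∣ n) → (d ∣ n → c ∣ m) → [ c ∣ m ] ≡ [ d ∣ n ]
[∣]-⇔ {c} {d} {m} {n} to from with c ℕ.∣? m | d ℕ.∣? n
... | yes _   | yes _   = refl
... | no  _   | no  _   = refl
... | yes c∣m | no  d∤n = contradiction (to c∣m) d∤n
... | no  c∤m | yes d∣n = contradiction (from d∣n) c∤m

[∣]-∤ : ∀ {d n} → d ℕ.∤ n → [ d ∣ n ] ≡ 0ℤ
[∣]-∤ {d} {n} d∤n with d ℕ.∣? n
... | yes d∣n = contradiction d∣n d∤n
... | no  _   = refl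

∑-mono-multiples : ∀ d N n .{{_ : ℕ.NonZero n}} → n ℕ.≤ N →
  ∑ N (λ x → mono (suc d * suc x) n) ≡ [ suc d ∣ n ]
∑-mono-multiples d N n n≤N with suc d ℕ.∣? n
... | no  d∤n = ∑-vanish N λ x → mono-off {suc d * suc x} {n} λ { refl → d∤n (ℕ.m∣m*n (suc x)) }
... | yes (ℕ.divides (suc q) refl) = ≡.trans
  (∑-single N (ℕ.≤-trans (ℕ.m≤m*n (suc q) (suc d)) n≤N)
    λ i i≢q → mono-off {suc d * suc i} λ eq → i≢q
      (ℕ.suc-injective (ℕ.*-cancelˡ-≡ (suc i) (suc q) (suc d) (≡.trans eq (ℕ.*-comm (suc q) (suc d))))))
  (≡.trans (≡.cong (mono (suc d * suc q)) (ℕ.*-comm (suc q) (suc d))) (mono-diag (suc d * suc q)))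

-- The range K is separate from n so that it can be cut into blocks of length p; every K ≥ n gives
-- the full divisor sum of a nonzero n.
σ≤ : ℕ → ℕ → ℤ
σ≤ K n = ∑ K λ a → + suc a ℤ.* [ suc a ∣ n ]

σ : ℕ → ℤ
σ n = σ≤ n n

S₁-σ : ∀ n .{{_ : ℕ.NonZero n}} → S₁ n n ≡ σ n
S₁-σ n = ∑-cong n λ a → ≡.trans (∑-*ˡ n (+ suc a) _)
  (≡.cong (+ suc a ℤ.*_) (∑-mono-multiples a n n ℕ.≤-refl))

σ≤-σ : ∀ {K} n .{{_ : ℕ.NonZero n}} → n ℕ.≤ K → σ≤ K n ≡ σ n
σ≤-σ {K} n n≤K with ℕ.m≤n⇒∃[o]m+o≡n n≤K
... | j , refl = ∑-extend n j _ λ a n≤a → ≡.trans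
  (≡.cong (+ suc a ℤ.*_) ([∣]-∤ (ℕ.>⇒∤ (s≤s n≤a)))) (ℤ.*-zeroʳ (+ suc a))

module PrimeStep (p-1 : ℕ) (p-prime : Prime (suc p-1)) where

  private
    p = suc p-1

  -- The sum of the divisors of n that are prime to p and less than K p.
  σ′ : ℕ → ℕ → ℤ
  σ′ K n = ∑ K λ k → ∑ p-1 λ r → + suc (r + k * p) ℤ.* [ suc (r + k * p) ∣ n ]

  σ≤-blocks : ∀ K n → σ≤ (K * p) n ≡ σ′ K n ℤ.+ ∑ K (λ k → + (suc k * p) ℤ.* [ suc k * p ∣ n ])
  σ≤-blocks K n = ≡.trans (∑-blocks p K _) (∑-+ K _ _)

  σ′-* : ∀ K n → σ′ K (n * p) ≡ σ′ K n
  σ′-* K n = ∑-cong K λ k → ∑-cong-< p-1 λ {r} r<p-1 →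
    ≡.cong (+ suc (r + k * p) ℤ.*_) ([∣]-⇔ (coprime-divisor (coprime k (s≤s r<p-1)) ∘ ≡.subst
      (suc (r + k * p) ∣_) (ℕ.*-comm n p)) (ℕ.∣m⇒∣m*n p))
    where
    coprime : ∀ k {r} → suc r ℕ.< p → Coprime (suc (r + k * p)) p
    coprime k {r} r<p (d∣ , d∣p) with prime⇒irreducible p-prime d∣p
    ... | inj₁ d≡1  = d≡1
    ... | inj₂ refl = contradiction
      (ℕ.∣m+n∣m⇒∣n (≡.subst (p ∣_) (ℕ.+-comm (suc r) (k * p)) d∣) (ℕ.n∣m*n k)) (ℕ.>⇒∤ r<p)

  -- The divisors of n p that are divisible by p are p times the divisors of n; those prime to p are
  -- the divisors of n prime to p.
  σ≤-* : ∀ K n → σ≤ (K * p) (n * p) ≡ + p ℤ.* σ≤ K n ℤ.+ σ′ K n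
  σ≤-* K n = ≡.trans (σ≤-blocks K (n * p)) (≡.trans (≡.cong₂ ℤ._+_ (σ′-* K n) multiples)
    (ℤ.+-comm (σ′ K n) _))
    where
    multiples : ∑ K (λ k → + (suc k * p) ℤ.* [ suc k * p ∣ n * p ]) ≡ + p ℤ.* σ≤ K n
    multiples = ≡.trans
      (∑-cong K λ k → ≡.trans
        (≡.cong₂ ℤ._*_ (≡.trans (≡.cong +_ (ℕ.*-comm (suc k) p)) (ℤ.pos-* p (suc k)))
          ([∣]-⇔ (ℕ.*-cancelʳ-∣ p) (ℕ.*-monoˡ-∣ p)))
        (ℤ.*-assoc (+ p) (+ suc k) [ suc k ∣ n ]))
      (∑-*ˡ K (+ p) _)

  -- No divisor of m is divisible by p, so the sum over divisors prime to p is the whole of σ m.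
  σ-∤ : ∀ m .{{_ : ℕ.NonZero m}} → p ℕ.∤ m → σ (m * p) ≡ (1ℤ ℤ.+ + p) ℤ.* σ m
  σ-∤ m p∤m = ≡.trans (σ≤-* m m) (≡.trans (≡.cong (ℤ._+_ (+ p ℤ.* σ m)) σ′≡σ) (lemma (+ p) (σ m)))
    where
    lemma : ∀ p s → p ℤ.* s ℤ.+ s ≡ (1ℤ ℤ.+ p) ℤ.* s
    lemma = solve-∀
    σ′≡σ : σ′ m m ≡ σ m
    σ′≡σ = ≡.trans
      (≡.sym (≡.trans (σ≤-blocks m m) (+-dropʳ (σ′ m m) (∑-vanish m λ k → ≡.trans
        (≡.cong (+ (suc k * p) ℤ.*_) ([∣]-∤ (p∤m ∘ ℕ.∣-trans (ℕ.n∣m*n (suc k)))))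
          (ℤ.*-zeroʳ (+ (suc k * p)))))))
      (σ≤-σ m (ℕ.m≤m*n m p))

  -- The Hecke recurrence. By `σ≤-*`, both σ(n p) - p σ(n) and σ(n p²) - p σ(n p) are the sum of the
  -- divisors of n prime to p, whether or not p divides n.
  σ-*-* : ∀ n .{{_ : ℕ.NonZero n}} → σ (n * p * p) ≡ (1ℤ ℤ.+ + p) ℤ.* σ (n * p) ℤ.- + p ℤ.* σ n
  σ-*-* n = begin
    σ (n * p * p)
      ≡⟨ ≡.trans (σ≤-* (n * p) (n * p)) (≡.cong (ℤ._+_ (+ p ℤ.* σ (n * p))) (σ′-* (n * p) n)) ⟩
    + p ℤ.* σ (n * p) ℤ.+ σ′ (n * p) n
      ≡⟨ lemma (+ p) (σ (n * p)) (σ n) (σ′ (n * p) n) ⟩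
    (1ℤ ℤ.+ + p) ℤ.* σ (n * p) ℤ.- + p ℤ.* σ n ℤ.+ (+ p ℤ.* σ n ℤ.+ σ′ (n * p) n ℤ.- σ (n * p))
      ≡⟨ +-dropʳ _ (ℤ.i≡j⇒i-j≡0 σ-*) ⟩
    (1ℤ ℤ.+ + p) ℤ.* σ (n * p) ℤ.- + p ℤ.* σ n
      ∎
    where
    open ≡.≡-Reasoning
    instance _ = ℕ.m*n≢0 n p
    σ-* : + p ℤ.* σ n ℤ.+ σ′ (n * p) n ≡ σ (n * p)
    σ-* = ≡.trans
      (≡.cong (λ s → + p ℤ.* s ℤ.+ σ′ (n * p) n) (≡.sym (σ≤-σ n (ℕ.m≤m*n n p))))
      (≡.trans (≡.sym (σ≤-* (n * p) n)) (σ≤-σ (n * p) (ℕ.m≤m*n (n * p) p)))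
    lemma : ∀ p s t u → p ℤ.* s ℤ.+ u ≡ (1ℤ ℤ.+ p) ℤ.* s ℤ.- p ℤ.* t ℤ.+ (p ℤ.* t ℤ.+ u ℤ.- s)
    lemma = solve-∀

  module _ (d : ℤ) (d∣ : d ℤ.∣ 1ℤ ℤ.+ + p ℤ.+ + p ℤ.* + p ℤ.+ + p ℤ.* + p ℤ.* + p)
           (m : ℕ) .{{_ : ℕ.NonZero m}} (p∤m : p ℕ.∤ m) where

    private
      n : ℕ → ℕ
      n zero    = m
      n (suc j) = n j * p

      n-nonZero : ∀ j → ℕ.NonZero (n j)
      n-nonZero zero    = ℕ.≢-nonZero (ℕ.≢-nonZero⁻¹ m)
      n-nonZero (suc j) = ℕ.m*n≢0 (n j) p {{n-nonZero j}}

      n≡ : ∀ j → n j ≡ m * p ^ j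
      n≡ zero    = ≡.sym (ℕ.*-identityʳ m)
      n≡ (suc j) = ≡.trans (≡.cong (_* p) (n≡ j))
        (≡.trans (ℕ.*-assoc m (p ^ j) p) (≡.cong (m *_) (ℕ.*-comm (p ^ j) p)))

      g : ℤ
      g = 1ℤ ℤ.+ + p ℤ.+ + p ℤ.* + p ℤ.+ + p ℤ.* + p ℤ.* + p

      step : ∀ j → σ (n (2 + j)) ≡ (1ℤ ℤ.+ + p) ℤ.* σ (n (1 + j)) ℤ.- + p ℤ.* σ (n j)
      step j = σ-*-* (n j) {{n-nonZero j}}

      σ₃ : σ (n 3) ≡ σ m ℤ.* g
      σ₃ = ≡.trans (step 1) (≡.trans
        (≡.cong₂ (λ s t → (1ℤ ℤ.+ + p) ℤ.* s ℤ.- + p ℤ.* t)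
          (≡.trans (step 0) (≡.cong (λ s → (1ℤ ℤ.+ + p) ℤ.* s ℤ.- + p ℤ.* σ m) σ₁)) σ₁)
        (lemma (+ p) (σ m)))
        where
        σ₁ = σ-∤ m p∤m
        lemma : ∀ p s →
          (1ℤ ℤ.+ p) ℤ.* ((1ℤ ℤ.+ p) ℤ.* ((1ℤ ℤ.+ p) ℤ.* s) ℤ.- p ℤ.* s)
            ℤ.- p ℤ.* ((1ℤ ℤ.+ p) ℤ.* s)
          ≡ s ℤ.* (1ℤ ℤ.+ p ℤ.+ p ℤ.* p ℤ.+ p ℤ.* p ℤ.* p)
        lemma = solve-∀

      -- Three uses of the recurrence give the coefficients g and -(p + p² + p³) = 1 - g. Modulo g
      -- the sequence therefore has period 4, and `σ₃` is a zero of it.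
      σ₄ : ∀ j → σ (n (4 + j)) ≡ σ (n (1 + j)) ℤ.* g ℤ.+ (1ℤ ℤ.- g) ℤ.* σ (n j)
      σ₄ j = ≡.trans (step (2 + j)) (≡.trans
        (≡.cong₂ (λ s t → (1ℤ ℤ.+ + p) ℤ.* s ℤ.- + p ℤ.* t)
          (≡.trans (step (1 + j)) (≡.cong (λ s → (1ℤ ℤ.+ + p) ℤ.* s ℤ.- + p ℤ.* σ (n (1 + j)))
            (step j))) (step j))
        (lemma (+ p) (σ (n (1 + j))) (σ (n j))))
        where
        lemma : ∀ p s t →
          (1ℤ ℤ.+ p) ℤ.* ((1ℤ ℤ.+ p) ℤ.* ((1ℤ ℤ.+ p) ℤ.* s ℤ.- p ℤ.* t) ℤ.- p ℤ.* s)
            ℤ.- p ℤ.* ((1ℤ ℤ.+ p) ℤ.* s ℤ.- p ℤ.* t)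
          ≡ s ℤ.* (1ℤ ℤ.+ p ℤ.+ p ℤ.* p ℤ.+ p ℤ.* p ℤ.* p)
            ℤ.+ (1ℤ ℤ.- (1ℤ ℤ.+ p ℤ.+ p ℤ.* p ℤ.+ p ℤ.* p ℤ.* p)) ℤ.* t
        lemma = solve-∀

      divides-σ : ∀ k → d ℤ.∣ σ (n (3 + k * 4))
      divides-σ zero    = ≡.subst (d ℤ.∣_) (≡.sym σ₃) (ℤ.∣n⇒∣m*n (σ m) d∣)
      divides-σ (suc k) = ≡.subst (d ℤ.∣_) (≡.sym (σ₄ (3 + k * 4)))
        (ℤ.∣m∣n⇒∣m+n (ℤ.∣n⇒∣m*n (σ (n (4 + k * 4))) d∣) (ℤ.∣n⇒∣m*n (1ℤ ℤ.- g) (divides-σ k)))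

    ∣-σ : ∀ k → d ℤ.∣ σ (m * p ^ (3 + k * 4))
    ∣-σ k = ≡.subst (λ n → d ℤ.∣ σ n) (n≡ (3 + k * 4)) (divides-σ k)

-- From divisor sums to the two congruences.

5∣b : ∀ n .{{_ : ℕ.NonZero n}} → + 5 ℤ.∣ σ n → 5 ∣ b 25 (n ∸ 1)
5∣b n@(suc n-1) 5∣σ = ℤ.∣⇒∣ᵤ (ℤ.∣m+n∣n⇒∣m {m = + b 25 n-1} {n = ℤ.- (+ n ℤ.* S₁ n n)} (b-congruence n-1)
  (ℤ.∣m⇒∣-m (ℤ.∣n⇒∣m*n (+ n) (≡.subst (+ 5 ℤ.∣_) (≡.sym (S₁-σ n)) 5∣σ))))

prime-∤-^ : ∀ {p} → Prime p → ∀ {a} → p ℕ.∤ a → ∀ k → p ℕ.∤ a ^ k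
prime-∤-^ p-prime p∤a zero    p∣1 = contradiction (ℕ.∣1⇒≡1 p∣1)
  (ℕ.nonTrivial⇒≢1 {{prime⇒nonTrivial p-prime}})
prime-∤-^ p-prime {a} p∤a (suc k) p∣ with euclidsLemma a (a ^ k) p-prime p∣
... | inj₁ p∣a  = p∤a p∣a
... | inj₂ p∣aᵏ = prime-∤-^ p-prime p∤a k p∣aᵏ

prime-∤-* : ∀ {p} → Prime p → ∀ {a c} → p ℕ.∤ a → p ℕ.∤ c → p ℕ.∤ a * c
prime-∤-* p-prime {a} {c} p∤a p∤c p∣ac with euclidsLemma a c p-prime p∣ac
... | inj₁ p∣a = p∤a p∣a
... | inj₂ p∣c = p∤c p∣c

module _ (p-1 : ℕ) (p-prime : Prime (suc p-1)) where
  private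
    p = suc p-1

  5∣b-prime-power : + 5 ℤ.∣ 1ℤ ℤ.+ + p ℤ.+ + p ℤ.* + p ℤ.+ + p ℤ.* + p ℤ.* + p →
    ∀ m .{{_ : ℕ.NonZero m}} → p ℕ.∤ m → ∀ k {n} → m * p ^ (3 + k * 4) ≡ n → 5 ∣ b 25 (n ∸ 1)
  5∣b-prime-power 5∣ m p∤m k refl = 5∣b (m * p ^ (3 + k * 4))
    {{ℕ.m*n≢0 m _ {{it}} {{ℕ.m^n≢0 p (3 + k * 4)}}}}
    (PrimeStep.∣-σ p-1 p-prime (+ 5) 5∣ m p∤m k)

corollary4p7 :
    ∀ (α β n i : ℕ) → α ≥ 1 → (i ≡ 1) ⊎ (i ≡ 2) →
      (5 ∣ b 25 (2 ^ (4 * β) * 3 ^ (4 * α) * n + (i + 3) * 2 ^ (4 * β) * 3 ^ (4 * α ∸ 1) ∸ 1))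
      × (5 ∣ b 25 (2 ^ (4 * α) * 3 ^ (4 * β) * n + 2 ^ (4 * α ∸ 1) * 3 ^ (4 * β + 1) ∸ 1))
corollary4p7 (suc k) β n i _ i∈ = first , second
  where
  -- In this form the exponent minus 1 reduces to 3 + k * 4, so the truncated subtraction
  -- disappears.
  4α : 4 * suc k ≡ suc (3 + k * 4)
  4α = ℕ.*-comm 4 (suc k)
  2-prime : Prime 2
  2-prime = from-yes (prime? 2)
  3-prime : Prime 3
  3-prime = from-yes (prime? 3)
  3∤i : ∀ {i} → (i ≡ 1) ⊎ (i ≡ 2) → 3 ℕ.∤ i
  3∤i (inj₁ refl) = ℕ.>⇒∤ (s≤s (s≤s z≤n))
  3∤i (inj₂ refl) = ℕ.>⇒∤ (s≤s (s≤s (s≤s z≤n)))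
  3∤i+3+3n : 3 ℕ.∤ i + 3 + 3 * n
  3∤i+3+3n 3∣ = 3∤i i∈ (ℕ.∣m+n∣m⇒∣n {m = 3 * suc n} (≡.subst (3 ∣_) (regroup i n) 3∣) (ℕ.m∣m*n (suc n)))
    where
    regroup : ∀ i n → i + 3 + 3 * n ≡ 3 * suc n + i
    regroup = ℕ-Solver.solve-∀
  2∤3 : 2 ℕ.∤ 3
  2∤3 2∣3 = contradiction (ℕ.∣m+n∣m⇒∣n {m = 2} {n = 1} 2∣3 ℕ.∣-refl) (ℕ.>⇒∤ (s≤s (s≤s z≤n)))
  2∤2n+3 : 2 ℕ.∤ 2 * n + 3
  2∤2n+3 2∣ = 2∤3 (ℕ.∣m+n∣m⇒∣n 2∣ (ℕ.m∣m*n n))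
  first : 5 ∣ b 25 (2 ^ (4 * β) * 3 ^ (4 * suc k) * n + (i + 3) * 2 ^ (4 * β) * 3 ^ (4 * suc k ∸ 1) ∸ 1)
  -- The argument increased by 1 is 2^(4β) (3 n + i + 3) 3^(4α-1). The prime 3 is passed as p - 1 =
  -- 2, and 1 + 3 + 9 + 27 = 8 * 5.
  first = 5∣b-prime-power 2 3-prime (ℤ.divides (+ 8) refl) (2 ^ (4 * β) * (i + 3 + 3 * n))
    {{ℕ.m*n≢0 (2 ^ (4 * β)) _ {{ℕ.m^n≢0 2 (4 * β)}}
      {{ℕ.>-nonZero (ℕ.≤-trans (s≤s z≤n) (ℕ.≤-trans (ℕ.m≤n+m 3 i) (ℕ.m≤m+n (i + 3) (3 * n))))}}}}
    (prime-∤-* 3-prime (prime-∤-^ 3-prime (ℕ.>⇒∤ ℕ.≤-refl) (4 * β)) 3∤i+3+3n) k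
    (≡.trans (lemma (2 ^ (4 * β)) i n (3 ^ (3 + k * 4)))
      (≡.cong (λ e → 2 ^ (4 * β) * 3 ^ e * n + (i + 3) * 2 ^ (4 * β) * 3 ^ (e ∸ 1)) (≡.sym 4α)))
    where
    lemma : ∀ a i n c → a * (i + 3 + 3 * n) * c ≡ a * (3 * c) * n + (i + 3) * a * c
    lemma = ℕ-Solver.solve-∀
  second : 5 ∣ b 25 (2 ^ (4 * suc k) * 3 ^ (4 * β) * n + 2 ^ (4 * suc k ∸ 1) * 3 ^ (4 * β + 1) ∸ 1)
  -- The argument increased by 1 is 3^(4β) (2 n + 3) 2^(4α-1), and 1 + 2 + 4 + 8 = 3 * 5.
  second = 5∣b-prime-power 1 2-prime (ℤ.divides (+ 3) refl) (3 ^ (4 * β) * (2 * n + 3))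
    {{ℕ.m*n≢0 (3 ^ (4 * β)) _ {{ℕ.m^n≢0 3 (4 * β)}}
      {{ℕ.>-nonZero (ℕ.≤-trans (s≤s z≤n) (ℕ.m≤n+m 3 (2 * n)))}}}}
    (prime-∤-* 2-prime (prime-∤-^ 2-prime 2∤3 (4 * β)) 2∤2n+3) k
    (≡.trans (lemma (3 ^ (4 * β)) n (2 ^ (3 + k * 4)))
      (≡.cong₂ (λ e f → 2 ^ e * 3 ^ (4 * β) * n + 2 ^ (e ∸ 1) * f) (≡.sym 4α)
        (≡.sym (ℕ.^-distribˡ-+-* 3 (4 * β) 1))))
    where
    lemma : ∀ a n c → a * (2 * n + 3) * c ≡ (2 * c) * a * n + c * (a * 3)
    lemma = ℕ-Solver.solve-∀
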